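{- Let $G$ be a bridgeless cubic graph, let $M$ be a perfect matching of $G$, and let $\mathcal M=\{A,B,C,D\}$ be an F-family for $M$. Then $G$ has a Fulkerson covering.
   Context: A Fulkerson covering of $G$ is a family of $6$ perfect matchings of $G$ (not necessarily distinct) such that every edge lies in exactly two of them. Let $M$ be a perfect matching of $G$; the cycles of $G\setminus M$ are the cycles of the $2$-factor obtained by deleting the edges of $M$. A set $X\subseteq E(G)$ is an $M$-balanced matching if there is a perfect matching $M_X$ of $G$ with $X=M\cap M_X$. Four pairwise disjoint $M$-balanced matchings $\mathcal M=\{A,B,C,D\}$ form an F-family for $M$ if: (i) for every odd cycle $\Gamma$ of $G\setminus M$ and every $X\in\mathcal M$, exactly one vertex of $\Gamma$ is incident with an edge of $X$ (so $\Gamma$ has exactly four vertices incident with edges of $A\cup B\cup C\cup D$, one for each member); (ii) every even cycle $\Gamma$ of $G\setminus M$ having a vertex incident with an edge of $A\cup B\cup C\cup D$ has exactly four such vertices, and either two of them are incident with edges of one member of $\mathcal M$ and the other two with edges of another member of $\mathcal M$, or all four are incident with edges of the same member of $\mathcal M$; (iii) for every cycle $\Gamma$ of $G\setminus M$ as in (i) or (ii), the subgraph of $G$ induced by the four vertices so determined has a perfect matching (a matching with two edges covering these four vertices). The set of edges of these chosen two-edge matchings, over all such cycles, is denoted $N$. -}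

module Defs where

open import Data.Nat using (ℕ; zero; suc; _+_)
open import Data.Fin using (Fin; zero; suc; _≟_)
open import Data.Bool using (Bool; true; false; _∧_; _∨_; not; if_then_else_; T)
open import Data.Product using (Σ; _×_; _,_; ∃; ∃-syntax)
open import Data.Sum using (_⊎_)
open import Relation.Binary.PropositionalEquality using (_≡_; _≢_)
open import Relation.Nullary using (¬_)
open import Relation.Nullary.Decidable using (⌊_⌋)

Even : ℕ → Set
Even k = ∃[ j ] k ≡ j + j

Odd : ℕ → Set
Odd k = ∃[ j ] k ≡ suc (j + j)

count : ∀ {k} → (Fin k → Bool) → ℕ
count {zero}  f = 0
count {suc k} f = (if f zero then 1 else 0) + count (λ i → f (suc i))

-- A finite (multi)graph: vertices Fin n, edges Fin m, edge e has ends u e, v e.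
record Graph : Set where
  field
    n : ℕ
    m : ℕ
    u : Fin m → Fin n
    v : Fin m → Fin n

module _ (G : Graph) where
  open Graph G

  Vertex : Set
  Vertex = Fin n

  Edge : Set
  Edge = Fin m

  EdgeSet : Set
  EdgeSet = Edge → Bool

  -- degree: a loop would be counted twice
  degree : Vertex → ℕ
  degree x = count (λ e → ⌊ u e ≟ x ⌋) + count (λ e → ⌊ v e ≟ x ⌋)

  Cubic : Set
  Cubic = ∀ x → degree x ≡ 3

  Joins : Edge → Vertex → Vertex → Set
  Joins e y z = (u e ≡ y × v e ≡ z) ⊎ (v e ≡ y × u e ≡ z)

  incident : Edge → Vertex → Bool
  incident e x = ⌊ u e ≟ x ⌋ ∨ ⌊ v e ≟ x ⌋

  data Reach (S : EdgeSet) (x : Vertex) : Vertex → Set where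
    here : Reach S x x
    step : ∀ {y z} (e : Edge) → Reach S x y → T (S e) → Joins e y z → Reach S x z

  Bridgeless : Set
  Bridgeless = ∀ e → Reach (λ f → not ⌊ f ≟ e ⌋) (u e) (v e)

  IsPerfectMatching : EdgeSet → Set
  IsPerfectMatching M = ∀ x → count (λ e → M e ∧ incident e x) ≡ 1

  FulkersonCovering : Set
  FulkersonCovering =
    Σ (Fin 6 → EdgeSet) λ F →
      (∀ i → IsPerfectMatching (F i)) × (∀ e → count (λ i → F i e) ≡ 2)

  HasSize : (Vertex → Set) → ℕ → Set
  HasSize P k = Σ (Fin k → Vertex) λ f →
    (∀ i j → f i ≡ f j → i ≡ j) × (∀ i → P (f i)) × (∀ w → P w → ∃[ i ] f i ≡ w)

  Balanced : EdgeSet → EdgeSet → Set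
  Balanced M X = Σ EdgeSet λ MX → IsPerfectMatching MX × (∀ e → X e ≡ (M e ∧ MX e))

  IncidentWith : EdgeSet → Vertex → Set
  IncidentWith X w = ∃[ e ] T (X e ∧ incident e w)

  module _ (M : EdgeSet) (F : Fin 4 → EdgeSet) where

    -- the cycle of G \ M through r (its vertex set)
    InCycle : Vertex → Vertex → Set
    InCycle r w = Reach (λ e → not (M e)) r w

    OddCycle : Vertex → Set
    OddCycle r = ∃[ k ] (Odd k × HasSize (InCycle r) k)

    EvenCycle : Vertex → Set
    EvenCycle r = ∃[ k ] (Even k × HasSize (InCycle r) k)

    IncidentAny : Vertex → Set
    IncidentAny w = ∃[ i ] IncidentWith (F i) w

    Marked : Vertex → Vertex → Set
    Marked r w = InCycle r w × IncidentAny w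

    MarkedBy : Vertex → Fin 4 → Vertex → Set
    MarkedBy r i w = InCycle r w × IncidentWith (F i) w

    -- condition (iii): the marked vertices of the cycle through r induce
    -- a subgraph with a perfect matching (two disjoint edges)
    InducedPM : Vertex → Set
    InducedPM r = ∃[ e₁ ] ∃[ e₂ ]
      ( Marked r (u e₁) × Marked r (v e₁) × Marked r (u e₂) × Marked r (v e₂)
      × u e₁ ≢ v e₁ × u e₁ ≢ u e₂ × u e₁ ≢ v e₂
      × v e₁ ≢ u e₂ × v e₁ ≢ v e₂ × u e₂ ≢ v e₂ )

    record FFamily : Set where
      field
        balanced : ∀ i → Balanced M (F i)
        disjoint : ∀ i j → i ≢ j → ∀ e → (F i e ∧ F j e) ≡ false
        oddCond  : ∀ r → OddCycle r → ∀ i → HasSize (MarkedBy r i) 1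
        evenCond : ∀ r → EvenCycle r → ∀ w → Marked r w →
                   HasSize (Marked r) 4 ×
                   ( (∃[ i ] ∃[ j ] (i ≢ j × HasSize (MarkedBy r i) 2 × HasSize (MarkedBy r j) 2))
                   ⊎ (∃[ i ] HasSize (MarkedBy r i) 4) )
        oddPM    : ∀ r → OddCycle r → InducedPM r
        evenPM   : ∀ r → EvenCycle r → ∀ w → Marked r w → InducedPM r

{-# OPTIONS --safe #-}

-- Let B i be a perfect matching with F i = M ∩ B i, and let N be the union of the two-edge matchings
-- of condition (iii). The covering consists of M, of (M ∖ ⋃ F i) ∪ N, and of the four matchings B i
-- corrected on the cycles of G ∖ M. With d(e) the number of B i containing e, plus one if e ∈ N, the
-- values of d on the two cycle edges at a vertex add up to 4, and d = 2 is wanted on every cycle. On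
-- an odd cycle it is automatic, since otherwise {d > 2} would be a perfect matching of the cycle. On
-- an even cycle at least two members of the family are absent; their traces can be redistributed
-- between the two colour classes of the cycle so that d = 2.
--
-- An edge of N may be a chord of an even cycle, hence an edge of M and of some F i. The covering then
-- uses it in M and in (M ∖ ⋃ F i) ∪ N, so it is dropped from F i, and B i is repaired on that cycle.
module Submission where

open import Defs
open import Data.Bool using (Bool; true; false; _∧_; _∨_; not; if_then_else_; T)
import Data.Bool as Bool
open import Data.Bool.Properties using (T-≡; ∨-comm; ∨-zeroʳ; ∧-zeroʳ; ∧-identityʳ; ∨-identityʳ)
open import Data.Empty using (⊥; ⊥-elim)
open import Data.Fin using (Fin; zero; suc; _≟_; punchIn; punchOut)
open import Data.Fin.Properties
  using (any?; pigeonhole; suc-injective; <⇒≢; punchIn-injective; punchInᵢ≢i; punchIn-punchOut)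
open import Data.Nat using (ℕ; zero; suc; _+_; _*_; _<ᵇ_)
import Data.Nat as ℕ
open import Data.Nat.Properties
  using (+-*-semiring; +-identityʳ; +-comm; +-suc; *-zeroʳ; *-identityʳ; n<1+n)
  renaming (suc-injective to ℕ-suc-injective)
open import Data.Nat.Tactic.RingSolver using (solve-∀)
open import Algebra.Properties.Semiring.Sum +-*-semiring
  using (sum; sum-cong-≗; ∑-distrib-+; ∑-comm; sum-remove; *-distribˡ-sum)
open import Data.Product using (Σ; _×_; _,_; ∃-syntax; proj₁; proj₂)
open import Data.Sum using (_⊎_; inj₁; inj₂; [_,_]′; swap)
open import Function using (_∘_; id)
open import Function.Bundles using (Equivalence)
open import Relation.Binary.PropositionalEquality
open import Relation.Nullary using (¬_; yes; no; contradiction; _×-dec_)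
open import Relation.Nullary.Decidable using (⌊_⌋)

-- Booleans, finite sums and parity

⟦_⟧ : Bool → ℕ
⟦ b ⟧ = if b then 1 else 0

T⇒≡ : ∀ {b} → T b → b ≡ true
T⇒≡ = Equivalence.to T-≡

≡⇒T : ∀ {b} → b ≡ true → T b
≡⇒T = Equivalence.from T-≡

∧-elim : ∀ {b c} → b ∧ c ≡ true → b ≡ true × c ≡ true
∧-elim {true} p = refl , p

∧-intro : ∀ {b c} → b ≡ true → c ≡ true → b ∧ c ≡ true
∧-intro refl refl = refl

∨-elim : ∀ {b c} → b ∨ c ≡ true → b ≡ true ⊎ c ≡ true
∨-elim {true}  p = inj₁ refl
∨-elim {false} p = inj₂ p

bool-cases : ∀ b → b ≡ true ⊎ b ≡ false
bool-cases true  = inj₁ refl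
bool-cases false = inj₂ refl

true≢false : ∀ {b} {A : Set} → b ≡ true → b ≡ false → A
true≢false refl ()

module _ {n : ℕ} {i j : Fin n} where
  ≟-true : i ≡ j → ⌊ i ≟ j ⌋ ≡ true
  ≟-true p with i ≟ j
  ... | yes _ = refl
  ... | no ¬p = contradiction p ¬p

  ≟-false : i ≢ j → ⌊ i ≟ j ⌋ ≡ false
  ≟-false ¬p with i ≟ j
  ... | yes p = contradiction p ¬p
  ... | no _  = refl

  ≟-true⁻¹ : ⌊ i ≟ j ⌋ ≡ true → i ≡ j
  ≟-true⁻¹ q with i ≟ j
  ... | yes p = p

count≡sum : ∀ {k} (f : Fin k → Bool) → count f ≡ sum (λ i → ⟦ f i ⟧)
count≡sum {zero}  f = refl
count≡sum {suc k} f = cong (⟦ f zero ⟧ +_) (count≡sum (f ∘ suc))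

sum-zero : ∀ {k} (f : Fin k → ℕ) → (∀ i → f i ≡ 0) → sum f ≡ 0
sum-zero {zero}  f z = refl
sum-zero {suc k} f z = cong₂ _+_ (z zero) (sum-zero (f ∘ suc) (z ∘ suc))

sum-δ : ∀ {k} (i : Fin k) (w : Fin k → ℕ) → sum (λ j → ⟦ ⌊ j ≟ i ⌋ ⟧ * w j) ≡ w i
sum-δ {suc k} i w = begin
  sum t                             ≡⟨ sum-remove {i = i} t ⟩
  t i + sum (λ j → t (punchIn i j)) ≡⟨ cong₂ _+_ (cong (λ b → ⟦ b ⟧ * w i) (≟-true {i = i} refl)) (sum-zero _ rest) ⟩
  w i + 0 + 0                       ≡⟨ trans (+-identityʳ _) (+-identityʳ _) ⟩
  w i                               ∎
  where
  open ≡-Reasoning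
  t : Fin (suc k) → ℕ
  t j = ⟦ ⌊ j ≟ i ⌋ ⟧ * w j
  rest : ∀ j → t (punchIn i j) ≡ 0
  rest j = cong (λ b → ⟦ b ⟧ * w (punchIn i j)) (≟-false (punchInᵢ≢i i j))

-- A weight `w` is read as a multiset of indices; one unit is removed at the first index of positive
-- weight. Quantifying over all `g` records the multiset, since indicator functions recover the
-- multiplicities.
sum-peel : ∀ {k j} (w : Fin k → ℕ) → sum w ≡ suc j →
           ∃[ a ] Σ (Fin k → ℕ) λ w′ → sum w′ ≡ j ×
             (∀ (g : Fin k → ℕ) → sum (λ i → g i * w i) ≡ g a + sum (λ i → g i * w′ i))
sum-peel {suc k} {j} w p with w zero
... | suc c = zero , w′ , p′ , λ g →
        lemma (g zero) c _
  where
  w′ : Fin (suc k) → ℕ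
  w′ zero    = c
  w′ (suc i) = w (suc i)
  p′ : c + sum (w ∘ suc) ≡ j
  p′ = ℕ-suc-injective p
  lemma : ∀ x y z → x * suc y + z ≡ x + (x * y + z)
  lemma = solve-∀
... | zero with sum-peel (w ∘ suc) p
... | a , w″ , q , h = suc a , w′ , q , λ g →
        trans (cong (g zero * 0 +_) (h (g ∘ suc))) (lemma (g zero) (g (suc a)) _)
  where
  w′ : Fin (suc k) → ℕ
  w′ zero    = 0
  w′ (suc i) = w″ i
  lemma : ∀ x y z → x * 0 + (y + z) ≡ y + (x * 0 + z)
  lemma = solve-∀

sum-empty : ∀ {k} (w : Fin k → ℕ) → sum w ≡ 0 → ∀ (g : Fin k → ℕ) → sum (λ i → g i * w i) ≡ 0
sum-empty {zero}  w p g = refl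
sum-empty {suc k} w p g with w zero
... | zero = cong₂ _+_ (*-zeroʳ (g zero)) (sum-empty (w ∘ suc) p (g ∘ suc))

-- Applied to the weights `inc e x` at a vertex of degree 3, this lists its three half-edges, with
-- repetition for a loop.
sum-three : ∀ {k} (w : Fin k → ℕ) → sum w ≡ 3 →
            ∃[ a ] ∃[ b ] ∃[ c ] (∀ (g : Fin k → ℕ) → sum (λ i → g i * w i) ≡ g a + (g b + g c))
sum-three w p =
  let a , w₁ , p₁ , h₁ = sum-peel w p
      b , w₂ , p₂ , h₂ = sum-peel w₁ p₁
      c , w₃ , p₃ , h₃ = sum-peel w₂ p₂
  in a , b , c , λ g →
     trans (h₁ g) (cong (g a +_) (trans (h₂ g) (cong (g b +_)
       (trans (h₃ g) (trans (cong (g c +_) (sum-empty w₃ p₃ g)) (+-identityʳ _))))))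

-- Isolates the two members of the family that are absent from an even cycle. The expansion of
-- `sum g` for every `g` expresses that no fifth letter exists.
four-letters : {i j : Fin 4} → i ≢ j →
               ∃[ c ] ∃[ d ] (c ≢ i × c ≢ j × d ≢ i × d ≢ j × d ≢ c ×
                 (∀ (g : Fin 4 → ℕ) → sum g ≡ g i + (g j + (g c + g d))))
four-letters {i} {j} i≢j =
  c , d , punchInᵢ≢i i _ , (λ q → punchInᵢ≢i j′ zero (punchIn-injective i _ _ (trans q (sym jj))))
  , punchInᵢ≢i i _ , (λ q → punchInᵢ≢i j′ (suc zero) (punchIn-injective i _ _ (trans q (sym jj))))
  , (λ q → contradiction (punchIn-injective j′ _ _ (punchIn-injective i _ _ q)) λ ())
  , λ g → trans (sum-remove {i = i} g) (cong (g i +_)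
      (trans (sum-remove {i = j′} (λ t → g (punchIn i t)))
        (cong₂ _+_ (cong g jj) (cong (g c +_) (+-identityʳ _)))))
  where
  j′ : Fin 3
  j′ = punchOut i≢j
  jj : punchIn i j′ ≡ j
  jj = punchIn-punchOut i≢j
  c d : Fin 4
  c = punchIn i (punchIn j′ zero)
  d = punchIn i (punchIn j′ (suc zero))

parity : ∀ k → Even k ⊎ Odd k
parity zero = inj₁ (0 , refl)
parity (suc k) with parity k
... | inj₁ (j , p) = inj₂ (j , cong suc p)
... | inj₂ (j , p) = inj₁ (suc j , cong suc (trans p (sym (+-suc j j))))

odd-not-even : ∀ i j → suc (i + i) ≢ j + j
odd-not-even zero    (suc j) p with trans p (cong suc (+-suc j j))
... | ()
odd-not-even (suc i) (suc j) p = odd-not-even i j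
  (trans (sym (+-suc i i)) (ℕ-suc-injective (trans (ℕ-suc-injective p) (+-suc j j))))

-- Provides the data of `HasSize` for a Boolean predicate, so that the size of a component class
-- becomes the length of a cycle.
enumerate : ∀ {k} (f : Fin k → Bool) → Σ (Fin (count f) → Fin k) λ g →
            (∀ i j → g i ≡ g j → i ≡ j) × (∀ i → f (g i) ≡ true) × (∀ w → f w ≡ true → ∃[ i ] g i ≡ w)
enumerate {zero}  f = (λ ()) , (λ ()) , (λ ()) , λ ()
enumerate {suc k} f with f zero in eq | enumerate (f ∘ suc)
... | true  | g , inj , snd , cmp = g′ , inj′ , snd′ , cmp′
  where
  g′ : Fin (suc (count (f ∘ suc))) → Fin (suc k)
  g′ zero    = zero
  g′ (suc i) = suc (g i)
  inj′ : ∀ i j → g′ i ≡ g′ j → i ≡ j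
  inj′ zero    zero    p = refl
  inj′ (suc i) (suc j) p = cong suc (inj i j (suc-injective p))
  snd′ : ∀ i → f (g′ i) ≡ true
  snd′ zero    = eq
  snd′ (suc i) = snd i
  cmp′ : ∀ w → f w ≡ true → ∃[ i ] g′ i ≡ w
  cmp′ zero    p = zero , refl
  cmp′ (suc w) p = let i , q = cmp w p in suc i , cong suc q
... | false | g , inj , snd , cmp = (λ i → suc (g i)) , (λ i j p → inj i j (suc-injective p)) , snd , cmp′
  where
  cmp′ : ∀ w → f w ≡ true → ∃[ i ] suc (g i) ≡ w
  cmp′ zero    p = true≢false p eq
  cmp′ (suc w) p = let i , q = cmp w p in i , cong suc q

-- Equivalence classes and connected components

-- Union-find: each edge redirects the representative of one end to that of the other.
module _ {n : ℕ} where
  merge : (s t y : Fin n) → Fin n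
  merge s t y = if ⌊ y ≟ s ⌋ then t else y

  find : ∀ {k} (p q : Fin k → Fin n) → Fin n → Fin n
  find {zero}  p q x = x
  find {suc k} p q x = merge (find (p ∘ suc) (q ∘ suc) (p zero)) (find (p ∘ suc) (q ∘ suc) (q zero)) (find (p ∘ suc) (q ∘ suc) x)

  merge-eq : ∀ s t → merge s t s ≡ merge s t t
  merge-eq s t rewrite ≟-true {i = s} refl with t ≟ s
  ... | yes _ = refl
  ... | no _  = refl

  find-joins : ∀ {k} (p q : Fin k → Fin n) e → find p q (p e) ≡ find p q (q e)
  find-joins p q zero    = merge-eq (find (p ∘ suc) (q ∘ suc) (p zero)) (find (p ∘ suc) (q ∘ suc) (q zero))
  find-joins p q (suc e) = cong (merge _ _) (find-joins (p ∘ suc) (q ∘ suc) e)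

  module _ (_~_ : Fin n → Fin n → Set) (~-refl : ∀ {x} → x ~ x)
           (~-sym : ∀ {x y} → x ~ y → y ~ x) (~-trans : ∀ {x y z} → x ~ y → y ~ z → x ~ z) where
    -- Redirection only follows the given pairs, so no equivalence containing them is ever left.
    -- Together with `find-joins`, this makes equality of representatives decide connectivity.
    find-sound : ∀ {k} (p q : Fin k → Fin n) → (∀ e → p e ~ q e) → ∀ x → x ~ find p q x
    find-sound {zero}  p q h x = ~-refl
    find-sound {suc k} p q h x with find (p ∘ suc) (q ∘ suc) x ≟ find (p ∘ suc) (q ∘ suc) (p zero)
    ... | no _  = find-sound (p ∘ suc) (q ∘ suc) (h ∘ suc) x
    ... | yes r = ~-trans (subst (x ~_) r (ih x)) (~-trans (~-sym (ih (p zero))) (~-trans (h zero) (ih (q zero))))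
      where ih = find-sound (p ∘ suc) (q ∘ suc) (h ∘ suc)

≟-swap : ∀ {n} (i j : Fin n) → ⌊ i ≟ j ⌋ ≡ ⌊ j ≟ i ⌋
≟-swap i j with i ≟ j
... | yes p = sym (≟-true (sym p))
... | no ¬p = sym (≟-false (¬p ∘ sym))

sum-indicator : ∀ {n} (i : Fin n) → sum (λ x → ⟦ ⌊ i ≟ x ⌋ ⟧) ≡ 1
sum-indicator i =
  trans (sum-cong-≗ λ x → trans (cong ⟦_⟧ (≟-swap i x)) (sym (*-identityʳ _))) (sum-δ i (λ _ → 1))

module Walks (G : Graph) (S : EdgeSet G) where
  open Graph G using (u; v)

  reach-trans : ∀ {x y z} → Reach G S x y → Reach G S y z → Reach G S x z
  reach-trans p here             = p
  reach-trans p (step e q s yz)  = step e (reach-trans p q) s yz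

  joins-sym : ∀ {e y z} → Joins G e y z → Joins G e z y
  joins-sym (inj₁ (p , q)) = inj₂ (q , p)
  joins-sym (inj₂ (p , q)) = inj₁ (q , p)

  reach-sym : ∀ {x y} → Reach G S x y → Reach G S y x
  reach-sym here            = here
  reach-sym (step e p s yz) = reach-trans (step e here s (joins-sym yz)) (reach-sym p)

  -- An edge outside `S` becomes a trivial link from `u e` to itself, so that `find` may run over
  -- all edges.
  target : Edge G → Vertex G
  target e = if S e then v e else u e

  component : Vertex G → Vertex G
  component = find u target

  component-edge : ∀ {e} → S e ≡ true → component (u e) ≡ component (v e)
  component-edge {e} s =
    trans (find-joins u target e) (cong (λ b → component (if b then v e else u e)) s)

  reach-component : ∀ x → Reach G S x (component x)
  reach-component = find-sound (Reach G S) here reach-sym reach-trans u target link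
    where
    link : ∀ e → Reach G S (u e) (target e)
    link e with S e in eq
    ... | true  = step e here (≡⇒T eq) (inj₁ (refl , refl))
    ... | false = here

  component-cong : ∀ {x y} → Reach G S x y → component x ≡ component y
  component-cong here = refl
  component-cong (step e p s (inj₁ (refl , refl))) = trans (component-cong p) (component-edge (T⇒≡ s))
  component-cong (step e p s (inj₂ (refl , refl))) = trans (component-cong p) (sym (component-edge (T⇒≡ s)))

  component-reach : ∀ {x y} → component x ≡ component y → Reach G S x y
  component-reach {x} {y} p =
    reach-trans (subst (Reach G S x) p (reach-component x)) (reach-sym (reach-component y))

-- Incidence and double counting

module Incidence (G : Graph) where
  open Graph G using (u; v)

  -- In contrast to `incident`, a loop counts twice, so the sums agree with `degree` before loops
  -- are excluded.
  inc : Edge G → Vertex G → ℕ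
  inc e x = ⟦ ⌊ u e ≟ x ⌋ ⟧ + ⟦ ⌊ v e ≟ x ⌋ ⟧

  IsEnd : Edge G → Vertex G → Set
  IsEnd e x = u e ≡ x ⊎ v e ≡ x

  inc-end : ∀ {e x} → IsEnd e x → inc e x ≢ 0
  inc-end (inj₁ p) q rewrite ≟-true p = contradiction q λ ()
  inc-end {e} {x} (inj₂ p) q rewrite ≟-true p = contradiction (trans (+-comm 1 ⟦ ⌊ u e ≟ x ⌋ ⟧) q) λ ()

  end-inc : ∀ {e x} → inc e x ≢ 0 → IsEnd e x
  end-inc {e} {x} q with u e ≟ x | v e ≟ x
  ... | yes p | _     = inj₁ p
  ... | no _  | yes p = inj₂ p
  ... | no _  | no _  = contradiction refl q

  sum-inc : ∀ x → sum (λ e → inc e x) ≡ degree G x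
  sum-inc x = trans (∑-distrib-+ (λ e → ⟦ ⌊ u e ≟ x ⌋ ⟧) (λ e → ⟦ ⌊ v e ≟ x ⌋ ⟧))
    (sym (cong₂ _+_ (count≡sum (λ e → ⌊ u e ≟ x ⌋)) (count≡sum (λ e → ⌊ v e ≟ x ⌋))))

  -- Double counting of the ends of `P`: exchanging the two sums gives two for each edge. It rules
  -- out a perfect matching of an odd cycle.
  handshake : (P : EdgeSet G) (C : Vertex G → Bool) →
              (∀ x → sum (λ e → ⟦ P e ⟧ * inc e x) ≡ ⟦ C x ⟧) → Even (count C)
  handshake P C h = count P , (begin
    count C                                       ≡⟨ count≡sum C ⟩
    sum (λ x → ⟦ C x ⟧)                           ≡⟨ sum-cong-≗ (λ x → sym (h x)) ⟩
    sum (λ x → sum (λ e → ⟦ P e ⟧ * inc e x))     ≡⟨ ∑-comm (λ x e → ⟦ P e ⟧ * inc e x) ⟩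
    sum (λ e → sum (λ x → ⟦ P e ⟧ * inc e x))     ≡⟨ sum-cong-≗ (λ e → sym (*-distribˡ-sum ⟦ P e ⟧ (inc e))) ⟩
    sum (λ e → ⟦ P e ⟧ * sum (inc e))             ≡⟨ sum-cong-≗ (λ e → cong (⟦ P e ⟧ *_) (ends e)) ⟩
    sum (λ e → ⟦ P e ⟧ * 2)                       ≡⟨ sum-cong-≗ (λ e → double ⟦ P e ⟧) ⟩
    sum (λ e → ⟦ P e ⟧ + ⟦ P e ⟧)                 ≡⟨ ∑-distrib-+ (λ e → ⟦ P e ⟧) (λ e → ⟦ P e ⟧) ⟩
    sum (λ e → ⟦ P e ⟧) + sum (λ e → ⟦ P e ⟧)     ≡⟨ cong (λ t → t + t) (sym (count≡sum P)) ⟩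
    count P + count P                             ∎)
    where
    open ≡-Reasoning
    double : ∀ t → t * 2 ≡ t + t
    double = solve-∀
    ends : ∀ e → sum (inc e) ≡ 2
    ends e = trans (∑-distrib-+ (λ x → ⟦ ⌊ u e ≟ x ⌋ ⟧) (λ x → ⟦ ⌊ v e ≟ x ⌋ ⟧))
                   (cong₂ _+_ (sum-indicator (u e)) (sum-indicator (v e)))

-- Absence of loops and the star of a vertex

module CubicBridgeless (G : Graph) (cubic : Cubic G) (bridgeless : Bridgeless G) where
  open Graph G using (u; v)
  open Incidence G public

  -- A loop at x occurs twice among a, b, c.
  abstract
    half-edges : ∀ x → ∃[ a ] ∃[ b ] ∃[ c ]
                 (∀ (g : Edge G → ℕ) → sum (λ e → g e * inc e x) ≡ g a + (g b + g c))
    half-edges x = sum-three (λ e → inc e x) (trans (sum-inc x) (cubic x))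

  -- The third half-edge at a vertex carrying a loop e is a bridge g.
  loop-bridge : ∀ {x e g} → u e ≡ x → v e ≡ x → g ≢ e →
                (∀ (h : Edge G → ℕ) → sum (λ f → h f * inc f x) ≡ h g + (h e + h e)) → ⊥
  loop-bridge {x} {e} {g} ue ve g≢e h = one-end (iff (bridgeless g))
    where
    inc-formula : ∀ f → inc f x ≡ ⟦ ⌊ g ≟ f ⌋ ⟧ + (⟦ ⌊ e ≟ f ⌋ ⟧ + ⟦ ⌊ e ≟ f ⌋ ⟧)
    inc-formula f = trans (sym (sum-δ f (λ d → inc d x))) (h (λ d → ⟦ ⌊ d ≟ f ⌋ ⟧))
    e-only : ∀ {f} → f ≢ g → IsEnd f x → f ≡ e
    e-only {f} f≢g p with e ≟ f in eq
    ... | yes q = sym q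
    ... | no ¬q = contradiction
          (trans (inc-formula f) (cong₂ (λ s t → ⟦ s ⟧ + (⟦ t ⟧ + ⟦ t ⟧)) (≟-false (f≢g ∘ sym)) (≟-false ¬q)))
          (inc-end p)
    both : ∀ {f y z} → f ≢ g → Joins G f y z → y ≡ x → z ≡ x
    both n (inj₁ (p , q)) r with refl ← e-only n (inj₁ (trans p r)) = trans (sym q) ve
    both n (inj₂ (p , q)) r with refl ← e-only n (inj₂ (trans p r)) = trans (sym q) ue
    avoid : ∀ {f} → T (not ⌊ f ≟ g ⌋) → f ≢ g
    avoid {f} t p with f ≟ g
    ... | no ¬p = ¬p p
    -- Invariant of walks avoiding `g`: at `x` they can use only the loop `e`, so they neither enter
    -- nor leave `x`.
    iff : ∀ {y z} → Reach G (λ f → not ⌊ f ≟ g ⌋) y z → (y ≡ x → z ≡ x) × (z ≡ x → y ≡ x)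
    iff here = id , id
    iff (step f p s j) = let to , from = iff p in
      both (avoid s) j ∘ to , from ∘ both (avoid s) (Walks.joins-sym G (λ _ → true) j)
    -- The multiplicity of `g` at `x` is one, so exactly one end of `g` is `x`, against the
    -- invariant.
    one-end : (u g ≡ x → v g ≡ x) × (v g ≡ x → u g ≡ x) → ⊥
    one-end (to , from) with u g ≟ x | v g ≟ x
      | trans (inc-formula g) (cong₂ (λ s t → ⟦ s ⟧ + (⟦ t ⟧ + ⟦ t ⟧)) (≟-true {i = g} refl) (≟-false (g≢e ∘ sym)))
    ... | yes p | no ¬q | _ = ¬q (to p)
    ... | no ¬p | yes q | _ = ¬p (from q)
    ... | yes _ | yes _ | ()
    ... | no _  | no _  | ()

  -- A loop fills exactly two of the three half-edges at its vertex. The three surviving cases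
  -- differ in the position of the third one, to which `loop-bridge` applies.
  no-loop : ∀ e → u e ≢ v e
  no-loop e loop with half-edges (v e)
  ... | a , b , c , h with a ≟ e | b ≟ e | c ≟ e
    | trans (sym (cong₂ (λ s t → ⟦ s ⟧ + ⟦ t ⟧) (≟-true loop) (≟-true {i = v e} refl)))
        (trans (sym (sum-δ e (λ d → inc d (v e)))) (h (λ d → ⟦ ⌊ d ≟ e ⌋ ⟧)))
  ... | no ¬p    | yes refl | yes refl | _ = loop-bridge loop refl ¬p h
  ... | yes refl | no ¬p    | yes refl | _ = loop-bridge loop refl ¬p λ g → trans (h g) (rotate (g a) (g b) (g c))
    where
    rotate : ∀ s t r → s + (t + r) ≡ t + (s + r)
    rotate = solve-∀
  ... | yes refl | yes refl | no ¬p    | _ = loop-bridge loop refl ¬p λ g → trans (h g) (rotate (g a) (g b) (g c))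
    where
    rotate : ∀ s t r → s + (t + r) ≡ r + (s + t)
    rotate = solve-∀
  ... | yes _ | yes _ | yes _ | ()
  ... | yes _ | no _  | no _  | ()
  ... | no _  | yes _ | no _  | ()
  ... | no _  | no _  | yes _ | ()
  ... | no _  | no _  | no _  | ()

  -- Without loops `incident` and `inc` agree, which turns matching conditions into weighted sums.
  count-inc : ∀ (P : EdgeSet G) x →
              count (λ e → P e ∧ incident G e x) ≡ sum (λ e → ⟦ P e ⟧ * inc e x)
  count-inc P x = trans (count≡sum (λ e → P e ∧ incident G e x)) (sum-cong-≗ pointwise)
    where
    pointwise : ∀ e → ⟦ P e ∧ incident G e x ⟧ ≡ ⟦ P e ⟧ * inc e x
    pointwise e with P e | u e ≟ x | v e ≟ x
    ... | false | _     | _     = refl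
    ... | true  | yes p | yes q = contradiction (trans p (sym q)) (no-loop e)
    ... | true  | yes _ | no _  = refl
    ... | true  | no _  | yes _ = refl
    ... | true  | no _  | no _  = refl

  module Matched (M : EdgeSet G) (pmM : IsPerfectMatching G M) where

    -- `m` is the edge of `M` at `x`, and `a`, `b` are the two edges of the 2-factor. The field
    -- `total` makes the list complete, so every identity at `x` involves just these three edges.
    record Star (x : Vertex G) : Set where
      field
        m a b : Edge G
        m∈M   : M m ≡ true
        a∉M   : M a ≡ false
        b∉M   : M b ≡ false
        total : ∀ (g : Edge G → ℕ) → sum (λ e → g e * inc e x) ≡ g m + (g a + g b)

    abstract
      -- Testing the half-edges on the indicator of `M` gives 1, so precisely one of the three lies
      -- in `M`.
      star : ∀ x → Star x
      star x with half-edges x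
      ... | p , q , r , h with M p in mp | M q in mq | M r in mr
        | trans (sym (h (λ e → ⟦ M e ⟧))) (trans (sym (count-inc M x)) (pmM x))
      ... | true  | false | false | _ = record
            { m = p; a = q; b = r; m∈M = mp; a∉M = mq; b∉M = mr; total = h }
      ... | false | true  | false | _ = record
            { m = q; a = p; b = r; m∈M = mq; a∉M = mp; b∉M = mr; total = λ g → trans (h g) (rotate (g p) (g q) (g r)) }
        where
        rotate : ∀ s t r → s + (t + r) ≡ t + (s + r)
        rotate = solve-∀
      ... | false | false | true  | _ = record
            { m = r; a = p; b = q; m∈M = mr; a∉M = mp; b∉M = mq; total = λ g → trans (h g) (rotate (g p) (g q) (g r)) }
        where
        rotate : ∀ s t r → s + (t + r) ≡ r + (s + t)
        rotate = solve-∀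
      ... | true  | true  | true  | ()
      ... | true  | true  | false | ()
      ... | true  | false | true  | ()
      ... | false | true  | true  | ()
      ... | false | false | false | ()

    m a b : Vertex G → Edge G
    m x = Star.m (star x)
    a x = Star.a (star x)
    b x = Star.b (star x)

    m∈M : ∀ x → M (m x) ≡ true
    m∈M x = Star.m∈M (star x)
    a∉M : ∀ x → M (a x) ≡ false
    a∉M x = Star.a∉M (star x)
    b∉M : ∀ x → M (b x) ≡ false
    b∉M x = Star.b∉M (star x)

    total : ∀ x (g : Edge G → ℕ) → sum (λ e → g e * inc e x) ≡ g (m x) + (g (a x) + g (b x))
    total x = Star.total (star x)

    inc-star : ∀ e x → inc e x ≡ ⟦ ⌊ m x ≟ e ⌋ ⟧ + (⟦ ⌊ a x ≟ e ⌋ ⟧ + ⟦ ⌊ b x ≟ e ⌋ ⟧)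
    inc-star e x = trans (sym (sum-δ e (λ d → inc d x))) (total x (λ d → ⟦ ⌊ d ≟ e ⌋ ⟧))

    star-edges : ∀ {e x} → IsEnd e x → e ≡ m x ⊎ e ≡ a x ⊎ e ≡ b x
    star-edges {e} {x} p with m x ≟ e | a x ≟ e | b x ≟ e | inc-star e x
    ... | yes q | _     | _     | _ = inj₁ (sym q)
    ... | no _  | yes q | _     | _ = inj₂ (inj₁ (sym q))
    ... | no _  | no _  | yes q | _ = inj₂ (inj₂ (sym q))
    ... | no _  | no _  | no _  | z = contradiction z (inc-end p)

    end-m : ∀ x → IsEnd (m x) x
    end-m x = end-inc λ z → positive (≟-true {i = m x} refl) (trans (sym (inc-star (m x) x)) z)
      where
      positive : ∀ {s t} → s ≡ true → ⟦ s ⟧ + t ≢ 0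
      positive refl ()

    end-a : ∀ x → IsEnd (a x) x
    end-a x = end-inc λ z → positive ⟦ ⌊ m x ≟ a x ⌋ ⟧ (≟-true {i = a x} refl) (trans (sym (inc-star (a x) x)) z)
      where
      positive : ∀ t {s r} → s ≡ true → t + (⟦ s ⟧ + r) ≢ 0
      positive zero refl ()

    end-b : ∀ x → IsEnd (b x) x
    end-b x = end-inc λ z →
      positive ⟦ ⌊ m x ≟ b x ⌋ ⟧ ⟦ ⌊ a x ≟ b x ⌋ ⟧ (≟-true {i = b x} refl) (trans (sym (inc-star (b x) x)) z)
      where
      positive : ∀ t r {s} → s ≡ true → t + (r + ⟦ s ⟧) ≢ 0
      positive zero zero refl ()

    star-M : ∀ {e x} → IsEnd e x → M e ≡ true → e ≡ m x
    star-M {x = x} p q with star-edges p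
    ... | inj₁ r           = r
    ... | inj₂ (inj₁ refl) = true≢false q (a∉M x)
    ... | inj₂ (inj₂ refl) = true≢false q (b∉M x)

    star-¬M : ∀ {e x} → IsEnd e x → M e ≡ false → e ≡ a x ⊎ e ≡ b x
    star-¬M {x = x} p q with star-edges p
    ... | inj₁ refl = true≢false (m∈M x) q
    ... | inj₂ r    = r

    -- With its converse `pm-from`, this makes a perfect matching a condition on single stars, which
    -- is what allows separate work on each cycle.
    pm-at : ∀ {P} → IsPerfectMatching G P → ∀ x → ⟦ P (m x) ⟧ + (⟦ P (a x) ⟧ + ⟦ P (b x) ⟧) ≡ 1
    pm-at {P} pmP x = trans (sym (total x (λ e → ⟦ P e ⟧))) (trans (sym (count-inc P x)) (pmP x))

    pm-from : ∀ {P} → (∀ x → ⟦ P (m x) ⟧ + (⟦ P (a x) ⟧ + ⟦ P (b x) ⟧) ≡ 1) → IsPerfectMatching G P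
    pm-from {P} h x = trans (count-inc P x) (trans (total x (λ e → ⟦ P e ⟧)) (h x))

-- Sets of prescribed size

module _ {A : Set} where
  three : A → A → A → Fin 3 → A
  three p q r zero             = p
  three p q r (suc zero)       = q
  three p q r (suc (suc zero)) = r

  three-injective : ∀ {p q r} → p ≢ q → p ≢ r → q ≢ r →
                    ∀ i j → three p q r i ≡ three p q r j → i ≡ j
  three-injective pq pr qr zero             zero             _ = refl
  three-injective pq pr qr (suc zero)       (suc zero)       _ = refl
  three-injective pq pr qr (suc (suc zero)) (suc (suc zero)) _ = refl
  three-injective pq pr qr zero             (suc zero)       e = contradiction e pq
  three-injective pq pr qr zero             (suc (suc zero)) e = contradiction e pr
  three-injective pq pr qr (suc zero)       (suc (suc zero)) e = contradiction e qr
  three-injective pq pr qr (suc zero)       zero             e = contradiction (sym e) pq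
  three-injective pq pr qr (suc (suc zero)) zero             e = contradiction (sym e) pr
  three-injective pq pr qr (suc (suc zero)) (suc zero)       e = contradiction (sym e) qr

  four : A → A → A → A → Fin 4 → A
  four p q r s zero    = p
  four p q r s (suc i) = three q r s i

  four-injective : ∀ {p q r s} → p ≢ q → p ≢ r → p ≢ s → q ≢ r → q ≢ s → r ≢ s →
                   ∀ i j → four p q r s i ≡ four p q r s j → i ≡ j
  four-injective pq pr ps qr qs rs zero    zero    _ = refl
  four-injective pq pr ps qr qs rs (suc i) (suc j) e = cong suc (three-injective qr qs rs i j e)
  four-injective {p} {q} {r} {s} pq pr ps qr qs rs zero (suc j) e = contradiction e (apart j)
    where
    apart : ∀ j → p ≢ three q r s j
    apart zero             = pq
    apart (suc zero)       = pr
    apart (suc (suc zero)) = ps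
  four-injective {p} {q} {r} {s} pq pr ps qr qs rs (suc i) zero e = contradiction (sym e) (apart i)
    where
    apart : ∀ j → p ≢ three q r s j
    apart zero             = pq
    apart (suc zero)       = pr
    apart (suc (suc zero)) = ps

module _ (G : Graph) {P : Vertex G → Set} where
  size-bound : ∀ {k} → HasSize G P k → (g : Fin (suc k) → Vertex G) →
               (∀ i j → g i ≡ g j → i ≡ j) → (∀ i → P (g i)) → ⊥
  size-bound (f , _ , _ , cmp) g inj Pg
    with i , j , i<j , q ← pigeonhole (n<1+n _) (λ i → proj₁ (cmp (g i) (Pg i))) =
    <⇒≢ i<j (inj i j (trans (sym (proj₂ (cmp (g i) (Pg i)))) (trans (cong f q) (proj₂ (cmp (g j) (Pg j))))))

  -- An element missed by `g` could be prepended to it, against the pigeonhole bound.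
  size-exhausted : ∀ {k} → HasSize G P k → (g : Fin k → Vertex G) →
                   (∀ i j → g i ≡ g j → i ≡ j) → (∀ i → P (g i)) → ∀ w → P w → ∃[ i ] g i ≡ w
  size-exhausted {k} size g inj Pg w Pw with any? (λ i → g i ≟ w)
  ... | yes found = found
  ... | no none   = ⊥-elim (size-bound size g′ inj′ Pg′)
    where
    g′ : Fin (suc k) → Vertex G
    g′ zero    = w
    g′ (suc i) = g i
    inj′ : ∀ i j → g′ i ≡ g′ j → i ≡ j
    inj′ zero    zero    _ = refl
    inj′ zero    (suc j) p = contradiction (j , sym p) none
    inj′ (suc i) zero    p = contradiction (i , p) none
    inj′ (suc i) (suc j) p = cong suc (inj i j p)
    Pg′ : ∀ i → P (g′ i)
    Pg′ zero    = Pw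
    Pg′ (suc i) = Pg i

-- Marks and pairings on a cycle

module Local (G : Graph) (cubic : Cubic G) (bridgeless : Bridgeless G)
             (M : EdgeSet G) (pmM : IsPerfectMatching G M)
             (F : Fin 4 → EdgeSet G) (ff : FFamily G M F) where
  open Graph G using (u; v)
  open CubicBridgeless G cubic bridgeless public
  open Matched M pmM public
  open Walks G (λ e → not (M e)) public
  open FFamily ff

  C : Vertex G → Vertex G → Set
  C = InCycle G M F

  B : Fin 4 → EdgeSet G
  B i = proj₁ (balanced i)

  F⇒M : ∀ {i e} → F i e ≡ true → M e ≡ true
  F⇒M {i} {e} p = proj₁ (∧-elim (trans (sym (proj₂ (proj₂ (balanced i)) e)) p))

  -- Boolean form of incidence with `F i`: since `F i` lies in `M`, only the edge `m x` can witness
  -- it.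
  mark : Fin 4 → Vertex G → Bool
  mark i x = F i (m x)

  mark-B : ∀ i x → B i (m x) ≡ mark i x
  mark-B i x = sym (trans (proj₂ (proj₂ (balanced i)) (m x)) (cong (_∧ B i (m x)) (m∈M x)))

  incident⇒mark : ∀ {i x} → IncidentWith G (F i) x → mark i x ≡ true
  incident⇒mark {i} {x} (e , t) with p , q ← ∧-elim (T⇒≡ t) | ∨-elim (proj₂ (∧-elim (T⇒≡ t)))
  ... | inj₁ r = subst (λ d → F i d ≡ true) (star-M (inj₁ (≟-true⁻¹ r)) (F⇒M p)) p
  ... | inj₂ r = subst (λ d → F i d ≡ true) (star-M (inj₂ (≟-true⁻¹ r)) (F⇒M p)) p

  mark⇒incident : ∀ {i x} → mark i x ≡ true → IncidentWith G (F i) x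
  mark⇒incident {i} {x} p = m x , ≡⇒T (∧-intro p (end⇒incident (end-m x)))
    where
    end⇒incident : ∀ {e} → IsEnd e x → incident G e x ≡ true
    end⇒incident {e} (inj₁ q) = cong (_∨ ⌊ v e ≟ x ⌋) (≟-true q)
    end⇒incident {e} (inj₂ q) = trans (cong (⌊ u e ≟ x ⌋ ∨_) (≟-true q)) (∨-zeroʳ ⌊ u e ≟ x ⌋)

  F-unique : ∀ {i j e} → F i e ≡ true → F j e ≡ true → i ≡ j
  F-unique {i} {j} {e} p q with i ≟ j
  ... | yes r = r
  ... | no ¬r = true≢false (∧-intro p q) (disjoint i j ¬r e)

  F-end : ∀ {i e x} → IsEnd e x → F i e ≡ true → mark i x ≡ true
  F-end {i} p q = subst (λ d → F i d ≡ true) (star-M p (F⇒M q)) q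

  sum-F-none : ∀ {e} → (∀ i → F i e ≡ false) → sum (λ i → ⟦ F i e ⟧) ≡ 0
  sum-F-none none = sum-zero _ (λ i → cong ⟦_⟧ (none i))

  sum-F-one : ∀ {i e} → F i e ≡ true → sum (λ j → ⟦ F j e ⟧) ≡ 1
  sum-F-one {i} {e} p = trans (sum-cong-≗ pointwise) (sum-δ i (λ _ → 1))
    where
    pointwise : ∀ j → ⟦ F j e ⟧ ≡ ⟦ ⌊ j ≟ i ⌋ ⟧ * 1
    pointwise j with j ≟ i | F j e in q
    ... | yes refl | true  = refl
    ... | yes refl | false = true≢false p q
    ... | no ¬r    | true  = contradiction (F-unique q p) ¬r
    ... | no _     | false = refl

  some-mark? : ∀ x → (∃[ i ] mark i x ≡ true) ⊎ (∀ i → mark i x ≡ false)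
  some-mark? x with any? (λ i → mark i x Bool.≟ true)
  ... | yes p = inj₁ p
  ... | no ¬p = inj₂ λ i → [ (λ q → contradiction (i , q) ¬p) , id ]′ (bool-cases (mark i x))

  B-at : ∀ i x → ⟦ mark i x ⟧ + (⟦ B i (a x) ⟧ + ⟦ B i (b x) ⟧) ≡ 1
  B-at i x = trans (cong (λ s → ⟦ s ⟧ + (⟦ B i (a x) ⟧ + ⟦ B i (b x) ⟧)) (sym (mark-B i x))) (pm-at (proj₁ (proj₂ (balanced i))) x)

  -- What one cycle contributes. `H i` replaces `B i` on the cycle edges. An edge of `F i` that lies
  -- in `N` leaves the `i`-th matching, hence the conjunction in `H-cover`. `N-in` is what later
  -- makes the choices on different cycles compatible.
  record Solution (r : Vertex G) : Set where
    field
      N       : EdgeSet G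
      H       : Fin 4 → EdgeSet G
      N-in    : ∀ {e x} → N e ≡ true → IsEnd e x → C r x
      N-cover : ∀ {x} → C r x → ⟦ N (m x) ⟧ + (⟦ N (a x) ⟧ + ⟦ N (b x) ⟧) ≡ sum (λ i → ⟦ mark i x ⟧)
      H-cover : ∀ {x} → C r x → ∀ i → ⟦ mark i x ∧ not (N (m x)) ⟧ + (⟦ H i (a x) ⟧ + ⟦ H i (b x) ⟧) ≡ 1
      twice   : ∀ {e x} → C r x → IsEnd e x → M e ≡ false → sum (λ i → ⟦ H i e ⟧) + ⟦ N e ⟧ ≡ 2

  -- The two-edge matching of condition (iii) on the cycle through r.
  record Pairing (r : Vertex G) : Set where
    field
      e₁ e₂ : Edge G
      in₁   : ∀ {x} → IsEnd e₁ x → C r x × ∃[ i ] mark i x ≡ true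
      in₂   : ∀ {x} → IsEnd e₂ x → C r x × ∃[ i ] mark i x ≡ true
      apart : ∀ {x} → IsEnd e₁ x → IsEnd e₂ x → ⊥
      cover : ∀ {x i} → C r x → mark i x ≡ true → IsEnd e₁ x ⊎ IsEnd e₂ x

    pair : EdgeSet G
    pair e = ⌊ e ≟ e₁ ⌋ ∨ ⌊ e ≟ e₂ ⌋

  flip-pairing : ∀ {r} → Pairing r → Pairing r
  flip-pairing p = record
    { e₁ = e₂ ; e₂ = e₁ ; in₁ = in₂ ; in₂ = in₁
    ; apart = λ s t → apart t s ; cover = λ c q → swap (cover c q) }
    where open Pairing p

  -- The four ends are distinct and marked, and only four vertices are marked, so `size-exhausted`
  -- gives `cover`.
  pairing : ∀ {r} → InducedPM G M F r → HasSize G (Marked G M F r) 4 → Pairing r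
  pairing {r} (e₁ , e₂ , mu₁ , mv₁ , mu₂ , mv₂ , u₁v₁ , u₁u₂ , u₁v₂ , v₁u₂ , v₁v₂ , u₂v₂) size = record
    { e₁ = e₁ ; e₂ = e₂
    ; in₁ = λ { (inj₁ refl) → marks mu₁ ; (inj₂ refl) → marks mv₁ }
    ; in₂ = λ { (inj₁ refl) → marks mu₂ ; (inj₂ refl) → marks mv₂ }
    ; apart = λ { (inj₁ p) (inj₁ q) → u₁u₂ (trans p (sym q)) ; (inj₁ p) (inj₂ q) → u₁v₂ (trans p (sym q))
                ; (inj₂ p) (inj₁ q) → v₁u₂ (trans p (sym q)) ; (inj₂ p) (inj₂ q) → v₁v₂ (trans p (sym q)) }
    ; cover = λ {x} {i} c q → locate (size-exhausted G size (four (u e₁) (v e₁) (u e₂) (v e₂))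
        (four-injective u₁v₁ u₁u₂ u₁v₂ v₁u₂ v₁v₂ u₂v₂) all-marked x (c , i , mark⇒incident q))
    }
    where
    marks : ∀ {x} → Marked G M F r x → C r x × ∃[ i ] mark i x ≡ true
    marks (c , i , q) = c , i , incident⇒mark q
    all-marked : ∀ k → Marked G M F r (four (u e₁) (v e₁) (u e₂) (v e₂) k)
    all-marked zero                   = mu₁
    all-marked (suc zero)             = mv₁
    all-marked (suc (suc zero))       = mu₂
    all-marked (suc (suc (suc zero))) = mv₂
    locate : ∀ {x} → ∃[ k ] four (u e₁) (v e₁) (u e₂) (v e₂) k ≡ x → IsEnd e₁ x ⊎ IsEnd e₂ x
    locate (zero , q)                   = inj₁ (inj₁ q)
    locate (suc zero , q)               = inj₁ (inj₂ q)
    locate (suc (suc zero) , q)         = inj₂ (inj₁ q)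
    locate (suc (suc (suc zero)) , q)   = inj₂ (inj₂ q)

  inc-one : ∀ {e x} → IsEnd e x → inc e x ≡ 1
  inc-one {e} {x} p with u e ≟ x | v e ≟ x
  ... | yes q | yes s = contradiction (trans q (sym s)) (no-loop e)
  ... | yes _ | no _  = refl
  ... | no _  | yes _ = refl
  inc-one (inj₁ p) | no ¬q | no _  = contradiction p ¬q
  inc-one (inj₂ p) | no _  | no ¬s = contradiction p ¬s

  inc-zero : ∀ {e x} → ¬ IsEnd e x → inc e x ≡ 0
  inc-zero {e} {x} ¬p = cong₂ (λ s t → ⟦ s ⟧ + ⟦ t ⟧) (≟-false (¬p ∘ inj₁)) (≟-false (¬p ∘ inj₂))

  module _ {r : Vertex G} (p : Pairing r) where
    open Pairing p

    pair-cases : ∀ {e} → pair e ≡ true → e ≡ e₁ ⊎ e ≡ e₂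
    pair-cases {e} q with ∨-elim {⌊ e ≟ e₁ ⌋} q
    ... | inj₁ s = inj₁ (≟-true⁻¹ s)
    ... | inj₂ s = inj₂ (≟-true⁻¹ s)

    pair-e₁ : pair e₁ ≡ true
    pair-e₁ = cong (_∨ ⌊ e₁ ≟ e₂ ⌋) (≟-true {i = e₁} refl)

    pair-e₂ : pair e₂ ≡ true
    pair-e₂ = trans (cong (⌊ e₂ ≟ e₁ ⌋ ∨_) (≟-true {i = e₂} refl)) (∨-zeroʳ ⌊ e₂ ≟ e₁ ⌋)

    pair-in : ∀ {e x} → pair e ≡ true → IsEnd e x → C r x
    pair-in {e} q s with pair-cases {e} q
    ... | inj₁ refl = proj₁ (in₁ s)
    ... | inj₂ refl = proj₁ (in₂ s)

    -- Both sides are 1 at a marked vertex and 0 elsewhere: on the left because the two edges are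
    -- disjoint and meet exactly the marked vertices, on the right because the family is disjoint.
    pair-cover : ∀ {x} → C r x →
                 ⟦ pair (m x) ⟧ + (⟦ pair (a x) ⟧ + ⟦ pair (b x) ⟧) ≡ sum (λ i → ⟦ mark i x ⟧)
    pair-cover {x} c = begin
      ⟦ pair (m x) ⟧ + (⟦ pair (a x) ⟧ + ⟦ pair (b x) ⟧)         ≡⟨ sym (total x (λ e → ⟦ pair e ⟧)) ⟩
      sum (λ e → ⟦ pair e ⟧ * inc e x)                            ≡⟨ sum-cong-≗ split ⟩
      sum (λ e → δ₁ e * inc e x + δ₂ e * inc e x)                 ≡⟨ ∑-distrib-+ (λ e → δ₁ e * inc e x) (λ e → δ₂ e * inc e x) ⟩
      sum (λ e → δ₁ e * inc e x) + sum (λ e → δ₂ e * inc e x)     ≡⟨ cong₂ _+_ (sum-δ e₁ (λ e → inc e x)) (sum-δ e₂ (λ e → inc e x)) ⟩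
      inc e₁ x + inc e₂ x                                         ≡⟨ count-ends (some-mark? x) ⟩
      sum (λ i → ⟦ mark i x ⟧)                                    ∎
      where
      open ≡-Reasoning
      δ₁ δ₂ : Edge G → ℕ
      δ₁ e = ⟦ ⌊ e ≟ e₁ ⌋ ⟧
      δ₂ e = ⟦ ⌊ e ≟ e₂ ⌋ ⟧
      e₁≢e₂ : e₁ ≢ e₂
      e₁≢e₂ q = apart (inj₁ refl) (inj₁ (cong u (sym q)))
      split : ∀ e → ⟦ pair e ⟧ * inc e x ≡ δ₁ e * inc e x + δ₂ e * inc e x
      split e with e ≟ e₁ | e ≟ e₂
      ... | yes s | yes t = contradiction (trans (sym s) t) e₁≢e₂
      ... | yes _ | no _  = sym (+-identityʳ _)
      ... | no _  | yes _ = refl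
      ... | no _  | no _  = refl
      count-ends : (∃[ i ] mark i x ≡ true) ⊎ (∀ i → mark i x ≡ false) →
                   inc e₁ x + inc e₂ x ≡ sum (λ i → ⟦ mark i x ⟧)
      count-ends (inj₁ (i , q)) with cover c q
      ... | inj₁ s = trans (cong₂ _+_ (inc-one s) (inc-zero (apart s))) (sym (sum-F-one q))
      ... | inj₂ s = trans (cong₂ _+_ (inc-zero (λ t → apart t s)) (inc-one s)) (sym (sum-F-one q))
      count-ends (inj₂ none) = trans
        (cong₂ _+_ (inc-zero λ s → let i , q = proj₂ (in₁ s) in true≢false q (none i))
                   (inc-zero λ s → let i , q = proj₂ (in₂ s) in true≢false q (none i)))
        (sym (sum-F-none none))

  -- Repairing a matching on an even cycle

  -- The letter `A` gives up its edges in `N`; on the cycle `B′` must match precisely the vertices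
  -- that `A` then no longer covers.
  Repair : Vertex G → EdgeSet G → Fin 4 → EdgeSet G → Set
  Repair r N A B′ = ∀ {x} → C r x →
    ⟦ mark A x ∧ not (N (m x)) ⟧ + (⟦ B′ (a x) ⟧ + ⟦ B′ (b x) ⟧) ≡ 1

  Alternating : Vertex G → EdgeSet G → Set
  Alternating r χ = ∀ {x} → C r x → ⟦ χ (a x) ⟧ + ⟦ χ (b x) ⟧ ≡ 1

  -- A common form for both alternatives of `evenCond` and for unmarked cycles. `exceed` says that a
  -- letter marking three distinct vertices accounts for all marks of the cycle.
  record EvenMarks (r : Vertex G) : Set where
    field
      i j    : Fin 4
      i≢j    : i ≢ j
      only   : ∀ {x k} → C r x → mark k x ≡ true → k ≡ i ⊎ k ≡ j
      exceed : ∀ A {p q s t k} → p ≢ q → p ≢ s → q ≢ s → C r p → C r q → C r s → C r t →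
               mark A p ≡ true → mark A q ≡ true → mark A s ≡ true → mark k t ≡ true → mark A t ≡ true

  module _ {r : Vertex G} (even : EvenMarks r) {χ : EdgeSet G} (alt : Alternating r χ) where
    open EvenMarks even

    dropped : ∀ s t → (s ≡ true → t ≡ true) → ⟦ s ∧ not t ⟧ ≡ 0
    dropped false t     h = refl
    dropped true  true  h = refl
    dropped true  false h = contradiction (h refl) λ ()

    -- Every edge of `F A` at the cycle is given up, so a whole colour class is the required
    -- matching.
    repair-full : ∀ A {N} → (∀ {x} → C r x → mark A x ≡ true → N (m x) ≡ true) → Repair r N A χ
    repair-full A {N} h {x} c = cong₂ _+_ (dropped (mark A x) (N (m x)) (h c)) (alt c)

    -- When e₁ is a chord in F A, the edge e₁ is dropped from F A and the perfect matching of F A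
    -- is replaced on the cycle by a colour class of χ, minus e₂ if the ends of e₂ remain marked by A.
    repair-chord : ∀ A (p : Pairing r) → F A (Pairing.e₁ p) ≡ true → ∃[ B′ ] Repair r (Pairing.pair p) A B′
    repair-chord A p Fe₁ = choose (bool-cases (M e₂)) (bool-cases (mark A (u e₂)))
      where
      open Pairing p
      at-e₁ : ∀ {x} → IsEnd e₁ x → pair (m x) ≡ true
      at-e₁ s = subst (λ d → pair d ≡ true) (star-M s (F⇒M Fe₁)) (pair-e₁ p)

      -- The ends of the chord `e₁` already carry `A`; an end of `e₂` with the letter `A` is a third
      -- vertex, so `exceed` applies.
      transfer : ∀ {x y} → IsEnd e₂ x → IsEnd e₂ y → mark A x ≡ true → mark A y ≡ true
      transfer s t q = exceed A (no-loop e₁) (λ z → apart (inj₁ z) s) (λ z → apart (inj₂ z) s)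
        (proj₁ (in₁ (inj₁ refl))) (proj₁ (in₁ (inj₂ refl))) (proj₁ (in₂ s)) (proj₁ (in₂ t))
        (F-end (inj₁ refl) Fe₁) (F-end (inj₂ refl) Fe₁) q (proj₂ (proj₂ (in₂ t)))

      module Cut (e₂∉M : M e₂ ≡ false) (q : mark A (u e₂) ≡ true) where
        -- Selects the colour class containing `e₂`; deleting `e₂` from it then exposes exactly the
        -- two ends of `e₂`.
        orient : Bool → Bool
        orient s = if χ e₂ then s else not s

        B′ : EdgeSet G
        B′ e = orient (χ e) ∧ not ⌊ e ≟ e₂ ⌋

        orient-e₂ : ∀ {s} → ⟦ χ e₂ ⟧ + ⟦ s ⟧ ≡ 1 → orient s ≡ false
        orient-e₂ {s} h with χ e₂ | s
        ... | true  | false = refl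
        ... | false | true  = refl

        orient-alt : ∀ s t → ⟦ s ⟧ + ⟦ t ⟧ ≡ 1 → ⟦ orient s ⟧ + ⟦ orient t ⟧ ≡ 1
        orient-alt s t h with χ e₂ | s | t
        ... | true  | true  | false = refl
        ... | true  | false | true  = refl
        ... | false | true  | false = refl
        ... | false | false | true  = refl

        B′-e₂ : ∀ {e} → e ≡ e₂ → B′ e ≡ false
        B′-e₂ {e} s = trans (cong (λ t → orient (χ e) ∧ not t) (≟-true s)) (∧-zeroʳ _)

        B′-partner : ∀ {e} → ⟦ χ e₂ ⟧ + ⟦ χ e ⟧ ≡ 1 → B′ e ≡ false
        B′-partner {e} h = cong (_∧ not ⌊ e ≟ e₂ ⌋) (orient-e₂ h)

        B′-other : ∀ {e} → e ≢ e₂ → B′ e ≡ orient (χ e)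
        B′-other {e} h with e ≟ e₂
        ... | yes s = contradiction s h
        ... | no _  = ∧-identityʳ _

        at-end : ∀ {x} → C r x → IsEnd e₂ x →
                 ⟦ mark A x ∧ not (pair (m x)) ⟧ + (⟦ B′ (a x) ⟧ + ⟦ B′ (b x) ⟧) ≡ 1
        at-end {x} c s = cong₂ (λ t w → ⟦ t ⟧ + w)
          (∧-intro (transfer (inj₁ refl) s q) (cong not (not-paired (bool-cases (pair (m x)))))) (no-B′ (star-¬M s e₂∉M))
          where
          not-paired : pair (m x) ≡ true ⊎ pair (m x) ≡ false → pair (m x) ≡ false
          not-paired (inj₂ n) = n
          not-paired (inj₁ y) with pair-cases p {m x} y
          ... | inj₁ z = ⊥-elim (apart (subst (λ d → IsEnd d x) z (end-m x)) s)
          ... | inj₂ z = true≢false (trans (sym (cong M z)) (m∈M x)) e₂∉M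
          no-B′ : e₂ ≡ a x ⊎ e₂ ≡ b x → ⟦ B′ (a x) ⟧ + ⟦ B′ (b x) ⟧ ≡ 0
          no-B′ (inj₁ z) = cong₂ (λ s t → ⟦ s ⟧ + ⟦ t ⟧) (B′-e₂ (sym z))
            (B′-partner (trans (cong (λ d → ⟦ χ d ⟧ + ⟦ χ (b x) ⟧) z) (alt c)))
          no-B′ (inj₂ z) = cong₂ (λ s t → ⟦ s ⟧ + ⟦ t ⟧)
            (B′-partner (trans (cong (λ d → ⟦ χ d ⟧ + ⟦ χ (a x) ⟧) z) (trans (+-comm ⟦ χ (b x) ⟧ _) (alt c))))
            (B′-e₂ (sym z))

        off-end : ∀ {x} → C r x → ¬ IsEnd e₂ x →
                  ⟦ mark A x ∧ not (pair (m x)) ⟧ + (⟦ B′ (a x) ⟧ + ⟦ B′ (b x) ⟧) ≡ 1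
        off-end {x} c s = cong₂ _+_ (dropped (mark A x) (pair (m x)) λ q′ → [ at-e₁ , (λ t → contradiction t s) ]′ (cover c q′))
          (trans (cong₂ (λ s t → ⟦ s ⟧ + ⟦ t ⟧) (B′-other (λ z → s (subst (λ d → IsEnd d x) z (end-a x))))
                                               (B′-other (λ z → s (subst (λ d → IsEnd d x) z (end-b x)))))
                 (orient-alt (χ (a x)) (χ (b x)) (alt c)))

        repaired : Repair r pair A B′
        repaired {x} c with u e₂ ≟ x | v e₂ ≟ x
        ... | yes s | _     = at-end c (inj₁ s)
        ... | no _  | yes s = at-end c (inj₂ s)
        ... | no s  | no t  = off-end c [ s , t ]′

      choose : M e₂ ≡ true ⊎ M e₂ ≡ false → mark A (u e₂) ≡ true ⊎ mark A (u e₂) ≡ false →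
               ∃[ B′ ] Repair r pair A B′
      choose (inj₂ n) (inj₁ q) = Cut.B′ n q , Cut.repaired n q
      -- In this case and the next, every vertex of the cycle marked by `A` has its `M`-edge in the
      -- pairing, so nothing of `A` is left there.
      choose (inj₁ e₂∈M) _ = χ , repair-full A {pair} λ c q → [ at-e₁ , at-e₂ ]′ (cover c q)
        where
        at-e₂ : ∀ {x} → IsEnd e₂ x → pair (m x) ≡ true
        at-e₂ s = subst (λ d → pair d ≡ true) (star-M s e₂∈M) (pair-e₂ p)
      choose (inj₂ _) (inj₂ n) = χ , repair-full A {pair} λ c q →
        [ at-e₁ , (λ s → true≢false (transfer s (inj₁ refl) q) n) ]′ (cover c q)

    -- If neither edge of the pairing is in `F A`, nothing is dropped and `B A` stays. Otherwise
    -- `repair-chord` applies, after `flip-pairing` if the edge in `F A` is `e₂`.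
    repair : ∀ A (p : Pairing r) → ∃[ B′ ] Repair r (Pairing.pair p) A B′
    repair A p = choose (bool-cases (F A e₁)) (bool-cases (F A e₂))
      where
      open Pairing p
      choose : F A e₁ ≡ true ⊎ F A e₁ ≡ false → F A e₂ ≡ true ⊎ F A e₂ ≡ false →
               ∃[ B′ ] Repair r pair A B′
      choose (inj₁ q) _ = repair-chord A p q
      choose (inj₂ _) (inj₁ q) = let B′ , h = repair-chord A (flip-pairing p) q in
        B′ , λ {x} c → trans (cong (λ s → ⟦ mark A x ∧ not s ⟧ + (⟦ B′ (a x) ⟧ + ⟦ B′ (b x) ⟧))
                                   (∨-comm ⌊ m x ≟ e₁ ⌋ ⌊ m x ≟ e₂ ⌋)) (h c)
      choose (inj₂ n₁) (inj₂ n₂) = B A , λ {x} _ →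
        trans (cong (λ s → ⟦ s ⟧ + (⟦ B A (a x) ⟧ + ⟦ B A (b x) ⟧)) (kept x (bool-cases (pair (m x))))) (B-at A x)
        where
        kept : ∀ x → pair (m x) ≡ true ⊎ pair (m x) ≡ false → mark A x ∧ not (pair (m x)) ≡ mark A x
        kept x (inj₁ y) = trans (cong (_∧ not (pair (m x))) unmarked) (sym unmarked)
          where
          unmarked : mark A x ≡ false
          unmarked with pair-cases p {m x} y
          ... | inj₁ z = trans (cong (F A) z) n₁
          ... | inj₂ z = trans (cong (F A) z) n₂
        kept x (inj₂ n) = trans (cong (λ s → mark A x ∧ not s) n) (∧-identityʳ _)

  -- Covering an even cycle twice

  -- The choice of an absent letter on an edge already covered `t` times: both absent letters take
  -- it when `t` is 0, the colour decides between them when `t` is 1, and neither takes it when `t`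
  -- is 2.
  select : ℕ → Bool → Bool
  select 0 s             = true
  select 1 s             = s
  select (suc (suc _)) s = false

  -- For values 1 and 1 the two colours differ; for 0 and 2 only the edge of value 0 is taken.
  select-alt : ∀ t w s s′ → t + w ≡ 2 → ⟦ s ⟧ + ⟦ s′ ⟧ ≡ 1 → ⟦ select t s ⟧ + ⟦ select w s′ ⟧ ≡ 1
  select-alt 0 2 s s′ p q = refl
  select-alt 1 1 s s′ p q = q
  select-alt 2 0 s s′ p q = refl

  select-pair : ∀ t w s → t + w ≡ 2 → t + (⟦ select t s ⟧ + ⟦ select t (not s) ⟧) ≡ 2
  select-pair 0 2 s     p = refl
  select-pair 1 1 true  p = refl
  select-pair 1 1 false p = refl
  select-pair 2 0 s     p = refl

  not-alt : ∀ s s′ → ⟦ s ⟧ + ⟦ s′ ⟧ ≡ 1 → ⟦ not s ⟧ + ⟦ not s′ ⟧ ≡ 1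
  not-alt true  false p = refl
  not-alt false true  p = refl

  -- The letters c and d are unmarked on the cycle: B c 2-colours it, and the colouring
  -- completes the covering given by the repaired matchings of i and j and by N.
  module Even {r : Vertex G} (even : EvenMarks r) where
    open EvenMarks even

    letters : ∃[ c ] ∃[ d ] (c ≢ i × c ≢ j × d ≢ i × d ≢ j × d ≢ c ×
                (∀ (g : Fin 4 → ℕ) → sum g ≡ g i + (g j + (g c + g d))))
    letters = four-letters i≢j

    c d : Fin 4
    c = proj₁ letters
    d = proj₁ (proj₂ letters)

    χ : EdgeSet G
    χ = B c

    unmarked : ∀ {k x} → k ≢ i → k ≢ j → C r x → mark k x ≡ false
    unmarked {k} {x} k≢i k≢j cx with bool-cases (mark k x)
    ... | inj₂ n = n
    ... | inj₁ q = ⊥-elim ([ k≢i , k≢j ]′ (only cx q))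

    unmarked-c : ∀ {x} → C r x → mark c x ≡ false
    unmarked-c = let c≢i , c≢j , _ = proj₂ (proj₂ letters) in unmarked c≢i c≢j

    unmarked-d : ∀ {x} → C r x → mark d x ≡ false
    unmarked-d = let _ , _ , d≢i , d≢j , _ = proj₂ (proj₂ letters) in unmarked d≢i d≢j

    χ-alternating : Alternating r χ
    χ-alternating {x} cx =
      trans (cong (λ s → ⟦ s ⟧ + (⟦ χ (a x) ⟧ + ⟦ χ (b x) ⟧)) (sym (unmarked-c cx))) (B-at c x)

    module _ (N : EdgeSet G) (N-in : ∀ {e x} → N e ≡ true → IsEnd e x → C r x)
             (N-cover : ∀ {x} → C r x → ⟦ N (m x) ⟧ + (⟦ N (a x) ⟧ + ⟦ N (b x) ⟧) ≡ sum (λ k → ⟦ mark k x ⟧))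
             (repaired : ∀ A → ∃[ B′ ] Repair r N A B′) where

      B′ : Fin 4 → EdgeSet G
      B′ A = proj₁ (repaired A)

      D : Edge G → ℕ
      D e = ⟦ B′ i e ⟧ + (⟦ B′ j e ⟧ + ⟦ N e ⟧)

      -- At an unmarked vertex each of the two letters uses a cycle edge. At a marked one either `N`
      -- takes the `M`-edge and both letters still use the cycle, or `N` takes a cycle edge in place
      -- of the marking letter.
      D-alternating : ∀ {x} → C r x → D (a x) + D (b x) ≡ 2
      D-alternating {x} cx = trans
        (regroup ⟦ B′ i (a x) ⟧ ⟦ B′ j (a x) ⟧ ⟦ N (a x) ⟧ ⟦ B′ i (b x) ⟧ ⟦ B′ j (b x) ⟧ ⟦ N (b x) ⟧)
        (combine (mark i x) (mark j x) (N (m x)) (λ p q → i≢j (F-unique p q))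
          (proj₂ (repaired i) cx) (proj₂ (repaired j) cx) (trans (N-cover cx) marks))
        where
        regroup : ∀ p q n p′ q′ n′ → (p + (q + n)) + (p′ + (q′ + n′)) ≡ (p + p′) + ((q + q′) + (n + n′))
        regroup = solve-∀
        marks : sum (λ k → ⟦ mark k x ⟧) ≡ ⟦ mark i x ⟧ + (⟦ mark j x ⟧ + 0)
        marks = trans (proj₂ (proj₂ (proj₂ (proj₂ (proj₂ (proj₂ (proj₂ letters)))))) (λ k → ⟦ mark k x ⟧))
          (cong (λ t → ⟦ mark i x ⟧ + (⟦ mark j x ⟧ + t))
            (cong₂ (λ s t → ⟦ s ⟧ + ⟦ t ⟧) (unmarked-c cx) (unmarked-d cx)))
        combine : ∀ fi fj n {p q w} → (fi ≡ true → fj ≡ true → ⊥) →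
                  ⟦ fi ∧ not n ⟧ + p ≡ 1 → ⟦ fj ∧ not n ⟧ + q ≡ 1 → ⟦ n ⟧ + w ≡ ⟦ fi ⟧ + (⟦ fj ⟧ + 0) →
                  p + (q + w) ≡ 2
        combine true  true  n     ¬both _ _ _ = ⊥-elim (¬both refl refl)
        combine true  false true  _ refl refl refl = refl
        combine true  false false _ refl refl refl = refl
        combine false true  true  _ refl refl refl = refl
        combine false true  false _ refl refl refl = refl
        combine false false true  _ _ _ ()
        combine false false false _ refl refl refl = refl

      H : Fin 4 → EdgeSet G
      H k e = if ⌊ k ≟ c ⌋ then select (D e) (χ e) else
              if ⌊ k ≟ d ⌋ then select (D e) (not (χ e)) else B′ k e

      H-c : ∀ e → H c e ≡ select (D e) (χ e)
      H-c e = cong (λ s → if s then select (D e) (χ e) else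
                          if ⌊ c ≟ d ⌋ then select (D e) (not (χ e)) else B′ c e) (≟-true {i = c} refl)

      H-d : ∀ e → H d e ≡ select (D e) (not (χ e))
      H-d e = let _ , _ , _ , _ , d≢c , _ = proj₂ (proj₂ letters) in
        cong₂ (λ s t → if s then select (D e) (χ e) else if t then select (D e) (not (χ e)) else B′ d e)
              (≟-false d≢c) (≟-true {i = d} refl)

      H-B′ : ∀ {k} → k ≢ c → k ≢ d → ∀ e → H k e ≡ B′ k e
      H-B′ {k} k≢c k≢d e =
        cong₂ (λ s t → if s then select (D e) (χ e) else if t then select (D e) (not (χ e)) else B′ k e)
              (≟-false k≢c) (≟-false k≢d)

      sum-H : ∀ e → sum (λ k → ⟦ H k e ⟧) + ⟦ N e ⟧ ≡ D e + (⟦ select (D e) (χ e) ⟧ + ⟦ select (D e) (not (χ e)) ⟧)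
      sum-H e = let c≢i , c≢j , d≢i , d≢j , _ , expand = proj₂ (proj₂ letters) in
        trans (cong (_+ ⟦ N e ⟧) (trans (expand (λ k → ⟦ H k e ⟧))
          (cong₂ (λ p q → ⟦ p ⟧ + q) (H-B′ (c≢i ∘ sym) (d≢i ∘ sym) e)
            (cong₂ (λ p q → ⟦ p ⟧ + q) (H-B′ (c≢j ∘ sym) (d≢j ∘ sym) e)
              (cong₂ (λ p q → ⟦ p ⟧ + ⟦ q ⟧) (H-c e) (H-d e))))))
        (regroup ⟦ B′ i e ⟧ ⟦ B′ j e ⟧ _ ⟦ N e ⟧)
        where
        regroup : ∀ p q s n → p + (q + s) + n ≡ (p + (q + n)) + s
        regroup = solve-∀

      even-solution : Solution r
      even-solution = record
        { N = N ; H = H ; N-in = N-in ; N-cover = N-cover ; H-cover = H-cover ; twice = twice }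
        where
        H-cover : ∀ {x} → C r x → ∀ k → ⟦ mark k x ∧ not (N (m x)) ⟧ + (⟦ H k (a x) ⟧ + ⟦ H k (b x) ⟧) ≡ 1
        H-cover {x} cx k with k ≟ c | k ≟ d
        ... | yes refl | _ = cong₂ (λ s t → ⟦ s ∧ not (N (m x)) ⟧ + t) (unmarked-c cx)
          (select-alt (D (a x)) (D (b x)) (χ (a x)) (χ (b x)) (D-alternating cx) (χ-alternating cx))
        ... | no _ | yes refl = cong₂ (λ s t → ⟦ s ∧ not (N (m x)) ⟧ + t) (unmarked-d cx)
          (select-alt (D (a x)) (D (b x)) (not (χ (a x))) (not (χ (b x))) (D-alternating cx)
            (not-alt (χ (a x)) (χ (b x)) (χ-alternating cx)))
        ... | no _ | no _ = proj₂ (repaired k) cx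
        twice : ∀ {e x} → C r x → IsEnd e x → M e ≡ false → sum (λ k → ⟦ H k e ⟧) + ⟦ N e ⟧ ≡ 2
        twice {e} {x} cx s n with star-¬M s n
        ... | inj₁ refl = trans (sum-H (a x)) (select-pair (D (a x)) (D (b x)) (χ (a x)) (D-alternating cx))
        ... | inj₂ refl = trans (sum-H (b x)) (select-pair (D (b x)) (D (a x)) (χ (b x))
                            (trans (+-comm (D (b x)) _) (D-alternating cx)))

  even-pairing-solution : ∀ {r} → EvenMarks r → Pairing r → Solution r
  even-pairing-solution even p = Even.even-solution even (Pairing.pair p) (λ {e} → pair-in p {e}) (pair-cover p)
    (λ A → repair even {Even.χ even} (Even.χ-alternating even) A p)

  -- By disjointness of the family the two pairs are four distinct vertices, hence all marked ones.
  -- Three vertices with one letter would exceed its size two, which settles `exceed`.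
  two-letters : ∀ {r i j} → i ≢ j → HasSize G (Marked G M F r) 4 →
                HasSize G (MarkedBy G M F r i) 2 → HasSize G (MarkedBy G M F r j) 2 → EvenMarks r
  two-letters {r} {i} {j} i≢j size sᵢ@(f , f-inj , f-in , _) sⱼ@(g , g-inj , g-in , _) = record
    { i = i ; j = j ; i≢j = i≢j ; only = only
    ; exceed = λ A pq ps qs cp cq cs ct mp mq ms mt → ⊥-elim (bound A pq ps qs cp cq cs mp mq ms) }
    where
    f≢g : ∀ s t → f s ≢ g t
    f≢g s t q = i≢j (F-unique (incident⇒mark (proj₂ (f-in s)))
                              (trans (cong (mark j) q) (incident⇒mark (proj₂ (g-in t)))))
    0≢1 : zero ≢ suc {1} zero
    0≢1 ()
    corners : Fin 4 → Vertex G
    corners = four (f zero) (f (suc zero)) (g zero) (g (suc zero))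
    corners-marked : ∀ k → Marked G M F r (corners k)
    corners-marked zero                   = proj₁ (f-in zero) , i , proj₂ (f-in zero)
    corners-marked (suc zero)             = proj₁ (f-in (suc zero)) , i , proj₂ (f-in (suc zero))
    corners-marked (suc (suc zero))       = proj₁ (g-in zero) , j , proj₂ (g-in zero)
    corners-marked (suc (suc (suc zero))) = proj₁ (g-in (suc zero)) , j , proj₂ (g-in (suc zero))
    only : ∀ {x k} → C r x → mark k x ≡ true → k ≡ i ⊎ k ≡ j
    only {x} {k} cx q with size-exhausted G size corners
        (four-injective (0≢1 ∘ f-inj _ _) (f≢g _ _) (f≢g _ _) (f≢g _ _) (f≢g _ _) (0≢1 ∘ g-inj _ _))
        corners-marked x (cx , k , mark⇒incident q)
    ... | zero                 , refl = inj₁ (F-unique q (incident⇒mark (proj₂ (f-in zero))))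
    ... | suc zero             , refl = inj₁ (F-unique q (incident⇒mark (proj₂ (f-in (suc zero)))))
    ... | suc (suc zero)       , refl = inj₂ (F-unique q (incident⇒mark (proj₂ (g-in zero))))
    ... | suc (suc (suc zero)) , refl = inj₂ (F-unique q (incident⇒mark (proj₂ (g-in (suc zero)))))
    triple : ∀ {A p q s} → C r p → C r q → C r s → mark A p ≡ true → mark A q ≡ true → mark A s ≡ true →
             ∀ k → MarkedBy G M F r A (three p q s k)
    triple cp cq cs mp mq ms zero             = cp , mark⇒incident mp
    triple cp cq cs mp mq ms (suc zero)       = cq , mark⇒incident mq
    triple cp cq cs mp mq ms (suc (suc zero)) = cs , mark⇒incident ms
    bound : ∀ A {p q s} → p ≢ q → p ≢ s → q ≢ s → C r p → C r q → C r s →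
            mark A p ≡ true → mark A q ≡ true → mark A s ≡ true → ⊥
    bound A {p} {q} {s} pq ps qs cp cq cs mp mq ms with only cp mp
    ... | inj₁ refl = size-bound G sᵢ (three p q s) (three-injective pq ps qs) (triple cp cq cs mp mq ms)
    ... | inj₂ refl = size-bound G sⱼ (three p q s) (three-injective pq ps qs) (triple cp cq cs mp mq ms)

  one-letter : ∀ {r i} → HasSize G (Marked G M F r) 4 → HasSize G (MarkedBy G M F r i) 4 → EvenMarks r
  one-letter {r} {i} size (f , f-inj , f-in , _) = record
    -- Any letter other than `i` may serve as `j`; it marks no vertex of this cycle.
    { i = i ; j = punchIn i zero ; i≢j = punchInᵢ≢i i zero ∘ sym
    ; only = λ cx q → inj₁ (F-unique q (marked-i cx q))
    ; exceed = λ A {p} {q} {s} {t} pq ps qs cp cq cs ct mp mq ms mt →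
        subst (λ k → mark k t ≡ true) (F-unique (marked-i cp mp) mp) (marked-i ct mt) }
    where
    marked-i : ∀ {x k} → C r x → mark k x ≡ true → mark i x ≡ true
    marked-i {x} {k} cx q with size-exhausted G size f f-inj (λ l → proj₁ (f-in l) , i , proj₂ (f-in l)) x (cx , k , mark⇒incident q)
    ... | l , refl = incident⇒mark (proj₂ (f-in l))

  -- With `N` empty each `B A` is its own repair, so the even construction runs with two arbitrary
  -- letters as `i` and `j`.
  no-marks : ∀ {r} → (∀ {x k} → C r x → mark k x ≡ true → ⊥) → Solution r
  no-marks {r} none = Even.even-solution even (λ _ → false) (λ ())
    (λ {x} cx → sym (sum-F-none λ k → [ (λ q → ⊥-elim (none cx q)) , id ]′ (bool-cases (mark k x))))
    (λ A → B A , λ {x} _ → trans (cong (λ s → ⟦ s ⟧ + (⟦ B A (a x) ⟧ + ⟦ B A (b x) ⟧)) (∧-identityʳ (mark A x))) (B-at A x))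
    where
    even : EvenMarks r
    even = record { i = zero ; j = suc zero ; i≢j = λ () ; only = λ cx q → ⊥-elim (none cx q)
                  ; exceed = λ A pq ps qs cp cq cs ct mp mq ms mt → ⊥-elim (none cp mp) }

  -- Odd cycles

  component-end : ∀ {e x} → M e ≡ false → IsEnd e x → component (u e) ≡ component x
  component-end n (inj₁ refl) = refl
  component-end n (inj₂ refl) = component-edge (cong not n)

  cycle-size : ∀ r → HasSize G (C r) (count (λ x → ⌊ component x ≟ component r ⌋))
  cycle-size r with g , inj , snd , cmp ← enumerate (λ x → ⌊ component x ≟ component r ⌋) =
    g , inj , (λ i → component-reach (sym (≟-true⁻¹ (snd i))))
    , λ w c → cmp w (≟-true (sym (component-cong c)))

  -- Otherwise {e | d e > 2} is a perfect matching of the odd cycle through r.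
  odd-constant : ∀ {r} → Odd (count (λ x → ⌊ component x ≟ component r ⌋)) → (d : Edge G → ℕ) →
                 (∀ {x} → C r x → d (a x) + d (b x) ≡ 4) →
                 ∀ {e x} → C r x → IsEnd e x → M e ≡ false → d e ≡ 2
  odd-constant {r} (k , odd) d four-at {e} {x} c s n with d e ℕ.≟ 2
  ... | yes q = q
  ... | no ¬q = let l , even = handshake χ (λ y → ⌊ component y ≟ component r ⌋) χ-matching in
    ⊥-elim (odd-not-even k l (trans (sym odd) even))
    where
    other : ∀ {p q} → p + q ≡ 4 → p ≡ 2 → q ≡ 2
    other {q = 2} refl refl = refl

    to-a : ∀ {f y} → C r y → IsEnd f y → M f ≡ false → d (a y) ≡ 2 → d f ≡ 2
    to-a {f} {y} cy t nf z with star-¬M t nf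
    ... | inj₁ refl = z
    ... | inj₂ refl = other (four-at cy) z

    from-a : ∀ {f y} → C r y → IsEnd f y → M f ≡ false → d f ≡ 2 → d (a y) ≡ 2
    from-a {f} {y} cy t nf z with star-¬M t nf
    ... | inj₁ refl = z
    ... | inj₂ refl = other (trans (+-comm (d (b y)) _) (four-at cy)) z

    not-true : ∀ {s} → T (not s) → s ≡ false
    not-true {false} _ = refl

    joined : ∀ {f y z} → Joins G f y z → IsEnd f y × IsEnd f z
    joined (inj₁ (p , q)) = inj₁ p , inj₂ q
    joined (inj₂ (p , q)) = inj₂ p , inj₁ q

    -- Two values with sum 4 are both 2 or both different from 2, so the value 2 spreads along the
    -- whole cycle.
    propagate : ∀ {y z} → C r y → C y z → d (a z) ≡ 2 → d (a y) ≡ 2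
    propagate cy here w = w
    propagate {y} cy (step {w} {z} f path t j) h = propagate cy path
      (from-a (reach-trans cy path) (proj₁ (joined j)) (not-true t)
        (to-a (reach-trans cy (step f path t j)) (proj₂ (joined j)) (not-true t) h))

    never : ∀ {y} → C r y → d (a y) ≢ 2
    never cy h = ¬q (to-a c s n (propagate c (reach-trans (reach-sym c) cy) h))

    χ : EdgeSet G
    χ f = (2 <ᵇ d f) ∧ (not (M f) ∧ ⌊ component (u f) ≟ component r ⌋)

    χ-M : ∀ {f} → M f ≡ true → χ f ≡ false
    χ-M {f} q = trans (cong (λ t → (2 <ᵇ d f) ∧ (not t ∧ ⌊ component (u f) ≟ component r ⌋)) q) (∧-zeroʳ _)

    χ-¬M : ∀ {f y} → IsEnd f y → M f ≡ false → χ f ≡ (2 <ᵇ d f) ∧ ⌊ component y ≟ component r ⌋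
    χ-¬M {f} t q = cong₂ (λ t z → (2 <ᵇ d f) ∧ (not t ∧ ⌊ z ≟ component r ⌋)) q (component-end q t)

    -- The sum is 4 and the value 2 is excluded everywhere by `never`, so exactly one of the two
    -- cycle edges exceeds 2.
    split : ∀ p q → p + q ≡ 4 → p ≢ 2 → ⟦ 2 <ᵇ p ⟧ + ⟦ 2 <ᵇ q ⟧ ≡ 1
    split 0 4 z ¬p = refl
    split 1 3 z ¬p = refl
    split 2 q z ¬p = contradiction refl ¬p
    split 3 1 z ¬p = refl
    split 4 0 z ¬p = refl

    χ-matching : ∀ y → sum (λ f → ⟦ χ f ⟧ * inc f y) ≡ ⟦ ⌊ component y ≟ component r ⌋ ⟧
    χ-matching y = trans (total y (λ f → ⟦ χ f ⟧))
      (trans (cong₂ (λ p q → ⟦ p ⟧ + q) (χ-M (m∈M y))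
        (cong₂ (λ p q → ⟦ p ⟧ + ⟦ q ⟧) (χ-¬M (end-a y) (a∉M y)) (χ-¬M (end-b y) (b∉M y)))) rest)
      where
      rest : ⟦ (2 <ᵇ d (a y)) ∧ ⌊ component y ≟ component r ⌋ ⟧ + ⟦ (2 <ᵇ d (b y)) ∧ ⌊ component y ≟ component r ⌋ ⟧
             ≡ ⟦ ⌊ component y ≟ component r ⌋ ⟧
      rest with component y ≟ component r
      ... | yes q = trans (cong₂ (λ s t → ⟦ s ⟧ + ⟦ t ⟧) (∧-identityʳ (2 <ᵇ d (a y))) (∧-identityʳ (2 <ᵇ d (b y))))
                          (split (d (a y)) (d (b y)) (four-at cy) (never cy))
        where
        cy : C r y
        cy = component-reach (sym q)
      ... | no _  = cong₂ (λ s t → ⟦ s ⟧ + ⟦ t ⟧) (∧-zeroʳ (2 <ᵇ d (a y))) (∧-zeroʳ (2 <ᵇ d (b y)))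

  -- Each letter marks a single vertex, so no edge of `M` enters the pairing and every `B i` is kept
  -- unchanged.
  odd-solution : ∀ {r} → Odd (count (λ x → ⌊ component x ≟ component r ⌋)) → Solution r
  odd-solution {r} odd = record
    { N = pair ; H = B ; N-in = λ {e} → pair-in p {e} ; N-cover = pair-cover p
    ; H-cover = λ {x} c i → trans (cong (λ s → ⟦ s ⟧ + (⟦ B i (a x) ⟧ + ⟦ B i (b x) ⟧)) (kept i c)) (B-at i x)
    ; twice = odd-constant odd d d-four }
    where
    oddCycle : OddCycle G M F r
    oddCycle = _ , odd , cycle-size r

    one : ∀ i → HasSize G (MarkedBy G M F r i) 1
    one = oddCond r oddCycle

    vertex : Fin 4 → Vertex G
    vertex i = proj₁ (one i) zero

    vertex-in : ∀ i → MarkedBy G M F r i (vertex i)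
    vertex-in i = proj₁ (proj₂ (proj₂ (one i))) zero

    vertex-complete : ∀ {i w} → C r w → mark i w ≡ true → vertex i ≡ w
    vertex-complete {i} {w} c q with proj₂ (proj₂ (proj₂ (one i))) w (c , mark⇒incident q)
    ... | zero , z = z

    p : Pairing r
    p = pairing (oddPM r oddCycle)
      ( vertex
      , (λ i j z → F-unique (incident⇒mark (proj₂ (vertex-in i)))
                            (trans (cong (mark j) z) (incident⇒mark (proj₂ (vertex-in j)))))
      , (λ i → proj₁ (vertex-in i) , i , proj₂ (vertex-in i))
      , λ w (c , i , q) → i , vertex-complete c (incident⇒mark q))
    open Pairing p

    -- The ends of a marked `M`-edge carry the same letter. On an odd cycle that letter has one
    -- vertex only, so the edge would be a loop.
    no-chord : ∀ {e} → pair e ≡ true → M e ≡ true → ⊥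
    no-chord {e} q e∈M = no-loop e (trans (sym (found (inj₁ refl))) (found (inj₂ refl)))
      where
      at : ∀ {x} → IsEnd e x → C r x × ∃[ i ] mark i x ≡ true
      at s with pair-cases p {e} q
      ... | inj₁ refl = in₁ s
      ... | inj₂ refl = in₂ s
      i : Fin 4
      i = proj₁ (proj₂ (at (inj₁ refl)))
      Fe : F i e ≡ true
      Fe = trans (cong (F i) (star-M (inj₁ refl) e∈M)) (proj₂ (proj₂ (at (inj₁ refl))))
      found : ∀ {x} → IsEnd e x → vertex i ≡ x
      found s = vertex-complete (proj₁ (at s)) (F-end s Fe)

    pair-m : ∀ x → pair (m x) ≡ false
    pair-m x = [ (λ q → ⊥-elim (no-chord {m x} q (m∈M x))) , id ]′ (bool-cases (pair (m x)))

    kept : ∀ i {x} → C r x → mark i x ∧ not (pair (m x)) ≡ mark i x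
    kept i {x} c = trans (cong (λ s → mark i x ∧ not s) (pair-m x)) (∧-identityʳ _)

    d : Edge G → ℕ
    d e = sum (λ i → ⟦ B i e ⟧) + ⟦ pair e ⟧

    -- Each of the four `B i` has one edge at `x`. If a letter uses `m x`, the pairing supplies a
    -- cycle edge in its place.
    d-four : ∀ {x} → C r x → d (a x) + d (b x) ≡ 4
    d-four {x} c = begin
      d (a x) + d (b x)                           ≡⟨ regroup (ΣB (a x)) ⟦ pair (a x) ⟧ (ΣB (b x)) ⟦ pair (b x) ⟧ ⟩
      0 + (⟦ pair (a x) ⟧ + ⟦ pair (b x) ⟧) + ΣBB  ≡⟨ cong (λ s → ⟦ s ⟧ + (⟦ pair (a x) ⟧ + ⟦ pair (b x) ⟧) + ΣBB) (sym (pair-m x)) ⟩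
      ⟦ pair (m x) ⟧ + (⟦ pair (a x) ⟧ + ⟦ pair (b x) ⟧) + ΣBB
                                                  ≡⟨ cong₂ _+_ (pair-cover p c) (sym (∑-distrib-+ (λ i → ⟦ B i (a x) ⟧) (λ i → ⟦ B i (b x) ⟧))) ⟩
      sum (λ i → ⟦ mark i x ⟧) + sum (λ i → ⟦ B i (a x) ⟧ + ⟦ B i (b x) ⟧)
                                                  ≡⟨ sym (∑-distrib-+ (λ i → ⟦ mark i x ⟧) (λ i → ⟦ B i (a x) ⟧ + ⟦ B i (b x) ⟧)) ⟩
      sum (λ i → ⟦ mark i x ⟧ + (⟦ B i (a x) ⟧ + ⟦ B i (b x) ⟧))
                                                  ≡⟨ sum-cong-≗ (λ i → B-at i x) ⟩
      4                                           ∎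
      where
      open ≡-Reasoning
      ΣB : Edge G → ℕ
      ΣB e = sum (λ i → ⟦ B i e ⟧)
      ΣBB : ℕ
      ΣBB = ΣB (a x) + ΣB (b x)
      regroup : ∀ s p t q → (s + p) + (t + q) ≡ 0 + (p + q) + (s + t)
      regroup = solve-∀

  -- Gluing the cycles

  -- `evenCond` speaks only of even cycles with a marked vertex, so the unmarked ones are separated
  -- by a finite search.
  solution : ∀ r → Solution r
  solution r with parity (count (λ x → ⌊ component x ≟ component r ⌋))
  ... | inj₂ odd  = odd-solution odd
  ... | inj₁ even with any? (λ x → (component r ≟ component x) ×-dec any? (λ i → mark i x Bool.≟ true))
  ...   | no none = no-marks λ {x} {k} c q → none (x , component-cong c , k , q)
  ...   | yes (x , c , k , q) = marked (evenCond r evenCycle x marked-x)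
    where
    evenCycle : EvenCycle G M F r
    evenCycle = _ , even , cycle-size r
    marked-x : Marked G M F r x
    marked-x = component-reach c , k , mark⇒incident q
    marked : HasSize G (Marked G M F r) 4 ×
             ( (∃[ i ] ∃[ j ] (i ≢ j × HasSize G (MarkedBy G M F r i) 2 × HasSize G (MarkedBy G M F r j) 2))
             ⊎ (∃[ i ] HasSize G (MarkedBy G M F r i) 4) ) → Solution r
    marked (size , inj₁ (i , j , i≢j , sᵢ , sⱼ)) =
      even-pairing-solution (two-letters i≢j size sᵢ sⱼ) (pairing (evenPM r evenCycle x marked-x) size)
    marked (size , inj₂ (i , sᵢ)) =
      even-pairing-solution (one-letter size sᵢ) (pairing (evenPM r evenCycle x marked-x) size)

  -- The solution is taken at the representative, so all vertices of a cycle share the same one.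
  local : ∀ x → Solution (component x)
  local x = solution (component x)

  on-cycle : ∀ x → C (component x) x
  on-cycle x = reach-sym (reach-component x)

  N : EdgeSet G
  N e = Solution.N (local (u e)) e

  H : Fin 4 → EdgeSet G
  H i e = Solution.H (local (u e)) i e

  same-cycle : ∀ {x y} → C (component x) y → component x ≡ component y
  same-cycle {x} c = component-cong (reach-trans (reach-component x) c)

  -- An `M`-edge may join two cycles. By `N-in` it then belongs to neither local `N`; any edge in a
  -- local `N` has both ends on that cycle.
  N-local : ∀ {e x} → IsEnd e x → N e ≡ Solution.N (local x) e
  N-local {e} {x} s with bool-cases (N e) | bool-cases (Solution.N (local x) e)
  ... | inj₂ p | inj₂ q = trans p (sym q)
  ... | inj₁ p | _      = cong (λ r → Solution.N (solution r) e) (same-cycle (Solution.N-in (local (u e)) p s))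
  ... | inj₂ _ | inj₁ q = cong (λ r → Solution.N (solution r) e) (sym (same-cycle (Solution.N-in (local x) q (inj₁ refl))))

  H-local : ∀ {e x} → IsEnd e x → M e ≡ false → ∀ i → H i e ≡ Solution.H (local x) i e
  H-local {e} s n i = cong (λ r → Solution.H (solution r) i e) (component-end n s)

  -- The six perfect matchings

  unmarked : EdgeSet G
  unmarked e = ⌊ sum (λ i → ⟦ F i e ⟧) ℕ.≟ 0 ⌋

  P : Fin 4 → EdgeSet G
  P i e = if M e then F i e ∧ not (N e) else H i e

  Q : EdgeSet G
  Q e = if M e then unmarked e ∨ N e else N e

  if-M : ∀ {A : Set} {s t : A} x → (if M (m x) then s else t) ≡ s
  if-M {s = s} {t} x = cong (if_then s else t) (m∈M x)

  if-¬M : ∀ {A : Set} {s t : A} {e} → M e ≡ false → (if M e then s else t) ≡ t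
  if-¬M {s = s} {t} n = cong (if_then s else t) n

  P-matching : ∀ i → IsPerfectMatching G (P i)
  P-matching i = pm-from {P i} λ x → trans
    (cong₂ (λ p q → ⟦ p ⟧ + q) (trans (if-M x) (cong (λ s → mark i x ∧ not s) (N-local (end-m x))))
      (cong₂ (λ p q → ⟦ p ⟧ + ⟦ q ⟧) (trans (if-¬M (a∉M x)) (H-local (end-a x) (a∉M x) i))
                                     (trans (if-¬M (b∉M x)) (H-local (end-b x) (b∉M x) i))))
    (Solution.H-cover (local x) (on-cycle x) i)

  N-at : ∀ x → ⟦ N (m x) ⟧ + (⟦ N (a x) ⟧ + ⟦ N (b x) ⟧) ≡ sum (λ i → ⟦ mark i x ⟧)
  N-at x = trans
    (cong₂ (λ p q → ⟦ p ⟧ + q) (N-local (end-m x))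
      (cong₂ (λ p q → ⟦ p ⟧ + ⟦ q ⟧) (N-local (end-a x)) (N-local (end-b x))))
    (Solution.N-cover (local x) (on-cycle x))

  sum-F≤1 : ∀ x → sum (λ i → ⟦ mark i x ⟧) ≡ 0 ⊎ sum (λ i → ⟦ mark i x ⟧) ≡ 1
  sum-F≤1 x with some-mark? x
  ... | inj₁ (i , q) = inj₂ (sum-F-one q)
  ... | inj₂ none    = inj₁ (sum-F-none none)

  -- At a vertex without a letter `N` is absent and `m x` is taken. At a marked vertex `m x` is
  -- taken only if it lies in `N`, and `N` covers the vertex once.
  Q-matching : IsPerfectMatching G Q
  Q-matching = pm-from {Q} λ x → trans
    (cong₂ (λ p q → ⟦ p ⟧ + q) (if-M x)
      (cong₂ (λ p q → ⟦ p ⟧ + ⟦ q ⟧) (if-¬M (a∉M x)) (if-¬M (b∉M x))))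
    (complete (N (m x)) (sum-F≤1 x) (N-at x))
    where
    complete : ∀ n {s t} → s ≡ 0 ⊎ s ≡ 1 → ⟦ n ⟧ + t ≡ s → ⟦ ⌊ s ℕ.≟ 0 ⌋ ∨ n ⟧ + t ≡ 1
    complete false (inj₁ refl) refl = refl
    complete true  (inj₁ refl) ()
    complete n     (inj₂ refl) h    = h

  six : Fin 6 → EdgeSet G
  six zero                = M
  six (suc zero)          = Q
  six (suc (suc i))       = P i

  six-matching : ∀ k → IsPerfectMatching G (six k)
  six-matching zero          = pmM
  six-matching (suc zero)    = Q-matching
  six-matching (suc (suc i)) = P-matching i

  -- Off `M` this is `twice` on the cycle of the edge. An edge of `M` lies in `M` itself and in one
  -- more matching: `Q` if it is in `N` or has no letter, otherwise that of its unique letter.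
  six-twice : ∀ e → count (λ k → six k e) ≡ 2
  six-twice e = trans (cong (λ t → ⟦ M e ⟧ + (⟦ Q e ⟧ + t)) (count≡sum (λ i → P i e))) (by-M (bool-cases (M e)))
    where
    by-M : M e ≡ true ⊎ M e ≡ false → ⟦ M e ⟧ + (⟦ Q e ⟧ + sum (λ i → ⟦ P i e ⟧)) ≡ 2
    by-M (inj₂ n) = trans
      (cong₂ _+_ (cong ⟦_⟧ n) (cong₂ _+_ (cong ⟦_⟧ (if-¬M n))
        (sum-cong-≗ λ i → cong ⟦_⟧ (cong (if_then F i e ∧ not (N e) else H i e) n))))
      (trans (+-comm ⟦ N e ⟧ _) (Solution.twice (local (u e)) (on-cycle (u e)) (inj₁ refl) n))
    by-M (inj₁ e∈M) = trans
      (cong₂ _+_ (cong ⟦_⟧ e∈M) (cong₂ _+_ (cong ⟦_⟧ (cong (if_then unmarked e ∨ N e else N e) e∈M))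
        (sum-cong-≗ λ i → cong ⟦_⟧ (cong (if_then F i e ∧ not (N e) else H i e) e∈M))))
      (cong suc (covered (N e) (subst (λ f → sum (λ i → ⟦ F i f ⟧) ≡ 0 ⊎ sum (λ i → ⟦ F i f ⟧) ≡ 1)
                                      (sym (star-M {x = u e} (inj₁ refl) e∈M)) (sum-F≤1 (u e)))))
      where
      covered : ∀ n → sum (λ i → ⟦ F i e ⟧) ≡ 0 ⊎ sum (λ i → ⟦ F i e ⟧) ≡ 1 →
                ⟦ unmarked e ∨ n ⟧ + sum (λ i → ⟦ F i e ∧ not n ⟧) ≡ 1
      covered true  _ = cong₂ _+_ (cong ⟦_⟧ (∨-zeroʳ (unmarked e)))
        (sum-zero _ (λ i → cong ⟦_⟧ (∧-zeroʳ (F i e))))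
      covered false h = trans
        (cong₂ _+_ (cong ⟦_⟧ (∨-identityʳ (unmarked e))) (sum-cong-≗ λ i → cong ⟦_⟧ (∧-identityʳ (F i e))))
        (unmarked-or-one h)
        where
        unmarked-or-one : ∀ {s} → s ≡ 0 ⊎ s ≡ 1 → ⟦ ⌊ s ℕ.≟ 0 ⌋ ⟧ + s ≡ 1
        unmarked-or-one (inj₁ refl) = refl
        unmarked-or-one (inj₂ refl) = refl

theorem4p1 : (G : Graph) → Cubic G → Bridgeless G →
    (M : EdgeSet G) → IsPerfectMatching G M →
    (F : Fin 4 → EdgeSet G) → FFamily G M F →
    FulkersonCovering G
theorem4p1 G cubic bridgeless M pmM F ff = six , six-matching , six-twice
  where open Local G cubic bridgeless M pmM F ff
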